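{- Let $m$ be a positive integer, let $B$ be a singleton board, let $N=|B|+1$, and write $B=(b_1,\dots,b_N)$ by padding with columns of height $0$ on the left. Let $n(\zeta_m(B))=(n_0,n_1,\dots)$. Then the number of singleton boards which are $m$-level rook equivalent to $B$ is $$ \prod_{i\ge0} \binom{n_{im}+n_{im+1}+\dots+n_{im+m}-1}{n_{im}-1,\,n_{im+1},\,n_{im+2},\,\dots,\,n_{im+m}}. $$
   Context: A Ferrers board $B=(b_1,\dots,b_n)$ ($0\le b_1\le\dots\le b_n$ integers) is the set of the $b_j$ lowest cells of column $j$ in the first-quadrant grid; boards are regarded as sets of cells, so sequences differing only by left columns of height $0$ are the same board; $|B|$ is its number of cells. $\lfloor n\rfloor_m$ is the largest multiple of $m$ that is $\le n$ and $\rho_m(n)=n-\lfloor n\rfloor_m$. $B$ is a singleton board if for all $i<n$, $\lfloor b_i\rfloor_m\ne b_i$ implies $\lfloor b_{i+1}\rfloor_m>\lfloor b_i\rfloor_m$. An $m$-zone is a maximal interval $z=[s,t]$ of column indices with $\lfloor b_s\rfloor_m=\dots=\lfloor b_t\rfloor_m$, and $\rho_m(z)=\sum_{j\in z}\rho_m(b_j)$. The $m$-level root vector is $\zeta_m(B)=(a_1,\dots,a_n)$ with $a_j=(j-1)m-\lfloor b_j\rfloor_m-\rho_m(z)$ if $j$ is last in its zone $z$, and $a_j=(j-1)m-\lfloor b_j\rfloor_m$ otherwise. For a finite vector $\nu$ of nonnegative integers, $n(\nu)=(n_0,n_1,\dots)$ where $n_i$ is the number of entries of $\nu$ equal to $i$.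 The $i$th level is rows $(i-1)m+1,\dots,im$; an $m$-level rook placement is a set of cells no two in the same level or column; $r_{k,m}(B)$ counts those with $k$ cells; $B,B'$ are $m$-level rook equivalent if $r_{k,m}(B)=r_{k,m}(B')$ for all $k$. -}

module Defs where

open import Data.Nat using (ℕ; zero; suc; _+_; _*_; _∸_; _≤_; _<_; NonZero)
open import Data.Nat.DivMod using (_/_; _%_)
open import Data.Nat.Combinatorics using (_C_)
open import Data.Integer as ℤ using (ℤ; +_)
open import Data.Nat.ListAction using (sum)
open import Data.List using (List; []; _∷_; length; concat; map; filter; filterᵇ; replicate; _++_; upTo; applyUpTo; foldr)
open import Data.List.Relation.Unary.Linked using (Linked)
open import Data.Bool using (Bool; true; false; if_then_else_; _∧_; not)
open import Data.Product using (_×_; _,_)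
open import Data.Unit using (⊤)
open import Relation.Binary.PropositionalEquality using (_≡_; _≢_)
open import Relation.Nullary.Decidable using (⌊_⌋)
import Data.Nat as ℕ

-- Ferrers boards.
-- A board (b_1,...,b_n) is a nondecreasing list of heights.  Since boards
-- are sets of cells, a board is represented canonically by the list with
-- all leading zero columns removed: a nondecreasing list whose first entry
-- (if any) is positive.

IsBoard : List ℕ → Set
IsBoard []       = ⊤
IsBoard (b ∷ bs) = (0 < b) × Linked _≤_ (b ∷ bs)

size : List ℕ → ℕ
size = sum

padTo : ℕ → List ℕ → List ℕ
padTo N b = replicate (N ∸ length b) 0 ++ b

flr : (m : ℕ) .{{_ : NonZero m}} → ℕ → ℕ
flr m n = (n / m) * m

rho : (m : ℕ) .{{_ : NonZero m}} → ℕ → ℕ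
rho m n = n ∸ flr m n

Singleton : (m : ℕ) .{{_ : NonZero m}} → List ℕ → Set
Singleton m []           = ⊤
Singleton m (b ∷ [])     = ⊤
Singleton m (b ∷ c ∷ bs) = (flr m b ≢ b → flr m b < flr m c) × Singleton m (c ∷ bs)

-- m-level root vector ζ_m(B), computed on the given list (b_1,...,b_n).
-- m-zones are the maximal runs of consecutive columns with equal ⌊b_j⌋_m.
-- zeta' m j acc bs : j = (index of head of bs) - 1,
--                    acc = sum of ρ_m over the earlier columns of the
--                          current zone.

zeta' : (m : ℕ) .{{_ : NonZero m}} → ℕ → ℕ → List ℕ → List ℤ
zeta' m j acc []           = []
zeta' m j acc (b ∷ [])     =
  (+ (j * m) ℤ.- + flr m b ℤ.- + (acc + rho m b)) ∷ []
zeta' m j acc (b ∷ c ∷ bs) =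
  if ⌊ flr m b ℕ.≟ flr m c ⌋
  then (+ (j * m) ℤ.- + flr m b) ∷ zeta' m (suc j) (acc + rho m b) (c ∷ bs)
  else (+ (j * m) ℤ.- + flr m b ℤ.- + (acc + rho m b)) ∷ zeta' m (suc j) 0 (c ∷ bs)

zeta : (m : ℕ) .{{_ : NonZero m}} → List ℕ → List ℤ
zeta m = zeta' m 0 0

cnt : List ℤ → ℕ → ℕ
cnt ν i = length (filter (λ x → x ℤ.≟ + i) ν)

multinomial : List ℕ → ℕ
multinomial []       = 1
multinomial (k ∷ ks) = ((k + sum ks) C k) * multinomial ks

-- The factor (n_0 + ... + n_m - 1 ; n_0 - 1, n_1, ..., n_m).
-- Convention: if n_0 = 0 it equals 1 when all n_i are 0 (the coefficient
-- (-1 ; -1, 0, ..., 0)) and 0 otherwise (a negative lower entry).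
blockFactor : ℕ → List ℕ → ℕ
blockFactor zero     ns = if ⌊ sum ns ℕ.≟ 0 ⌋ then 1 else 0
blockFactor (suc n0) ns = multinomial (n0 ∷ ns)

factor : (m : ℕ) → (ℕ → ℕ) → ℕ → ℕ
factor m n i = blockFactor (n (i * m)) (applyUpTo (λ k → n (i * m + suc k)) m)

prodUpTo : ℕ → (ℕ → ℕ) → ℕ
prodUpTo K f = foldr _*_ 1 (map f (upTo K))

-- m-level rook numbers.
-- Cells (column, row), columns numbered 1..n, rows 1..b_j.

Cell : Set
Cell = ℕ × ℕ

cells' : ℕ → List ℕ → List Cell
cells' j []       = []
cells' j (b ∷ bs) = map (λ r → (j , suc r)) (upTo b) ++ cells' (suc j) bs

cells : List ℕ → List Cell
cells = cells' 1

subsets : {A : Set} → List A → List (List A)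
subsets []       = [] ∷ []
subsets (x ∷ xs) = let s = subsets xs in s ++ map (x ∷_) s

-- level of row r (r ≥ 1) is ⌈r/m⌉; we record (r-1)/m
level : (m : ℕ) .{{_ : NonZero m}} → ℕ → ℕ
level m r = (r ∸ 1) / m

compatible : (m : ℕ) .{{_ : NonZero m}} → Cell → Cell → Bool
compatible m (j , r) (j' , r') =
  not ⌊ j ℕ.≟ j' ⌋ ∧ not ⌊ level m r ℕ.≟ level m r' ⌋

allB : {A : Set} → (A → Bool) → List A → Bool
allB p []       = true
allB p (x ∷ xs) = p x ∧ allB p xs

isPlacement : (m : ℕ) .{{_ : NonZero m}} → List Cell → Bool
isPlacement m []       = true
isPlacement m (c ∷ cs) = allB (compatible m c) cs ∧ isPlacement m cs

rook : (m : ℕ) .{{_ : NonZero m}} → ℕ → List ℕ → ℕ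
rook m k b =
  length (filterᵇ (λ s → ⌊ length s ℕ.≟ k ⌋ ∧ isPlacement m s) (subsets (cells b)))

LevelRookEquiv : (m : ℕ) .{{_ : NonZero m}} → List ℕ → List ℕ → Set
LevelRookEquiv m b b' = (k : ℕ) → rook m k b ≡ rook m k b'

module Submission where

-- In a singleton board every zone has its only nonzero remainder in its last column, so the
-- root vector is simply a_j = (j - 1) m - b_j.  Adding a column of height b to such a board,
-- k rooks already placed each block exactly m of its cells; this gives
-- r_{k+1}(B, b) = r_{k+1}(B) + (b - k m) r_k(B), which says that the rook numbers are the
-- coefficients of ∏ (x - a_j) in the basis x (x - m) ⋯ (x - (i - 1) m).  Hence two boards
-- are equivalent iff their root vectors are rearrangements of each other.
--
-- In terms of the root vector, being a singleton board means a_1 = 0 and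
-- a_{j+1} ≤ (⌊a_j / m⌋ + 1) m.  Such words are built by inserting the letters in decreasing
-- order: a letter v with (i - 1) m ≤ v < i m may stand in front of any letter not exceeding i m
-- or at the end, except that one letter (i - 1) m has to come first.  Each insertion
-- contributes one binomial coefficient of the multinomial coefficient of its block.

open import Defs
open import Algebra.Properties.CommutativeSemigroup using (interchange)
open import Data.Bool using (Bool; true; false; T?; if_then_else_; _∧_; not)
open import Data.Bool.Properties using (∧-comm; ∧-zeroʳ)
import Data.Integer as ℤ
import Data.Integer.Properties as ℤₚ
open import Data.Integer.Tactic.RingSolver using (solve-∀)
open import Data.List using (List; []; _∷_; _++_; _∷ʳ_; length; map; filter; filterᵇ; concatMap; upTo; applyUpTo; foldr; replicate; reverse)
open import Data.List.Membership.Propositional using (_∈_; find; lose)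
open import Data.List.Membership.Propositional.Properties using (∈-map⁺; ∈-map⁻; ∈-++⁺ˡ; ∈-++⁺ʳ; ∈-++⁻; ∈-concatMap⁺; ∈-concatMap⁻; ∈-∃++)
open import Data.List.Properties using (length-map; length-++; length-replicate; map-upTo; ++-assoc; ++-identityʳ; unfold-reverse; reverse-involutive; filter-++; filter-accept; filter-reject; filter-all)
open import Data.List.Relation.Binary.Permutation.Propositional as Perm using (_↭_; ↭-sym; ↭-trans; ↭-reflexive)
import Data.List.Relation.Binary.Permutation.Propositional.Properties as Permₚ
open import Data.List.Relation.Unary.All as All using (All; []; _∷_)
import Data.List.Relation.Unary.All.Properties as Allₚ
open import Data.List.Relation.Unary.AllPairs using (AllPairs; []; _∷_)
import Data.List.Relation.Unary.AllPairs.Properties as AllPairsₚ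
open import Data.List.Relation.Unary.Any using (here; there)
open import Data.List.Relation.Unary.Linked as Linked using (Linked; []; [-]; _∷_)
open import Data.List.Relation.Unary.Linked.Properties using (Linked⇒All; Linked⇒AllPairs)
open import Data.List.Relation.Unary.Unique.Propositional using (Unique)
import Data.List.Relation.Unary.Unique.Propositional.Properties as Uniq
open import Data.Nat as ℕ using (ℕ; zero; suc; z≤n; s≤s; z<s; s<s; NonZero; _≟_)
open import Data.Nat.Combinatorics using (_C_; nCk+nC[k+1]≡[n+1]C[k+1]; nCn≡1)
open import Data.Nat.Divisibility using (divides-refl)
open import Data.Nat.DivMod using (_/_; _%_; m≡m%n+[m/n]*n; m%n<n; /-monoˡ-≤; m*n/n≡m; m/n*n≤m; m<n*o⇒m/o<n; +-distrib-/-∣ˡ; m<n⇒m/n≡0)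
open import Data.Nat.ListAction using (sum)
open import Data.Nat.ListAction.Properties using (sum-↭)
import Data.Nat.Properties as ℕₚ
open import Data.Product using (Σ; ∃; _×_; _,_; proj₁; proj₂)
open import Data.Sum using (inj₁; inj₂)
open import Data.Unit using (⊤; tt)
open import Function using (_∘_; flip; _⇔_; mk⇔; Equivalence)
open import Relation.Binary.Definitions using (tri<; tri≈; tri>)
open import Relation.Binary.PropositionalEquality
open import Relation.Nullary using (¬_; Dec; yes; no; contradiction)
open import Relation.Nullary.Decidable using (¬?; ⌊_⌋; isYes≗does; dec-true; dec-false)

-- The length `N = |B| + 1` makes all boards comparable. The number of placements of one rook is the
-- number of cells, so an equivalent singleton board has the size of `B`, and once it is padded to
-- `N` columns its root vector has no negative entry. Heights and roots then determine each other by
-- the same formula `j * m ∸ _`, columns being numbered from 0, and what remains is to count words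
-- of natural numbers with prescribed letter counts. Neighbouring blocks share a letter: `suc i * m`
-- is the last letter of block `i` and the first of block `suc i`. Deleting all letters below
-- `suc i * m` leaves a word whose first letter is at most `suc i * m`, hence equal to it. The words
-- on the higher letters are therefore of the kind wanted, with `suc i` for `i`, and the product
-- arises by recursion over the blocks.

module Words where

  open import Data.Nat using (_+_; _*_; _≤_; _<_; _≤?_)
  open import Data.Nat.Properties hiding (_≟_)

  private variable
    A X : Set

  -- Exact enumerations by lists without repetition

  Enumerates : (A → Set) → List A → Set
  Enumerates P L = Unique L × (∀ x → x ∈ L ⇔ P x)

  -- The map `g` reads off from a member of `f x` the `x` it came from, so the lists for different
  -- `x` are disjoint.
  concatMap-unique : {f : X → List A} (g : A → X) (L : List X) → Unique L →
    (∀ {x} → x ∈ L → Unique (f x)) → (∀ {x y} → x ∈ L → y ∈ f x → g y ≡ x) →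
    Unique (concatMap f L)
  concatMap-unique g []      []          uf gf = []
  concatMap-unique {f = f} g (x ∷ L) (x∉L ∷ uL) uf gf =
    Uniq.++⁺ (uf (here refl)) (concatMap-unique g L uL (uf ∘ there) (gf ∘ there)) disjoint
    where
    disjoint : ∀ {y} → y ∈ f x × y ∈ concatMap f L → _
    disjoint (p , q) with find (∈-concatMap⁻ f q)
    ... | z , z∈L , y∈fz =
      All.lookup x∉L z∈L (trans (sym (gf (here refl) p)) (gf (there z∈L) y∈fz))

  concatMap-length : (f : X → List A) (c : ℕ) (L : List X) →
    (∀ {x} → x ∈ L → length (f x) ≡ c) → length (concatMap f L) ≡ c * length L
  concatMap-length f c []      h = sym (*-zeroʳ c)
  concatMap-length f c (x ∷ L) h = begin
    length (f x ++ concatMap f L)            ≡⟨ length-++ (f x) ⟩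
    length (f x) + length (concatMap f L)    ≡⟨ cong₂ _+_ (h (here refl)) (concatMap-length f c L (h ∘ there)) ⟩
    c + c * length L                         ≡⟨ *-suc c (length L) ⟨
    c * suc (length L)                       ∎
    where open ≡-Reasoning

  -- Counting and deleting letters

  count : ℕ → List ℕ → ℕ
  count i w = length (filter (_≟ i) w)

  delete : ℕ → List ℕ → List ℕ
  delete v = filter (λ x → ¬? (x ≟ v))

  small : ℕ → List ℕ → ℕ
  small T w = length (filter (_≤? T) w)

  small-accept : ∀ {T x} → x ≤ T → ∀ w → small T (x ∷ w) ≡ suc (small T w)
  small-accept {T} x≤T w = cong length (filter-accept (_≤? T) {xs = w} x≤T)

  small-reject : ∀ {T x} → ¬ x ≤ T → ∀ w → small T (x ∷ w) ≡ small T w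
  small-reject {T} x≰T w = cong length (filter-reject (_≤? T) {xs = w} x≰T)

  count-here : ∀ v w → count v (v ∷ w) ≡ suc (count v w)
  count-here v w = cong length (filter-accept (_≟ v) {xs = w} refl)

  count-there : ∀ {i x} → x ≢ i → ∀ w → count i (x ∷ w) ≡ count i w
  count-there {i} x≢i w = cong length (filter-reject (_≟ i) {xs = w} x≢i)

  delete-here : ∀ v w → delete v (v ∷ w) ≡ delete v w
  delete-here v w = filter-reject (λ x → ¬? (x ≟ v)) {xs = w} (λ ¬p → ¬p refl)

  delete-there : ∀ {v x} → x ≢ v → ∀ w → delete v (x ∷ w) ≡ x ∷ delete v w
  delete-there {v} x≢v w = filter-accept (λ x → ¬? (x ≟ v)) {xs = w} x≢v

  delete-all : ∀ {v} w → All (v <_) w → delete v w ≡ w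
  delete-all {v} w v<w = filter-all (λ x → ¬? (x ≟ v)) (All.map >⇒≢ v<w)

  count-none : ∀ {i} w → All (_≢ i) w → count i w ≡ 0
  count-none []      []          = refl
  count-none (x ∷ w) (x≢i ∷ w≢i) = trans (count-there x≢i w) (count-none w w≢i)

  count-delete : ∀ {i v} → i ≢ v → ∀ w → count i (delete v w) ≡ count i w
  count-delete i≢v [] = refl
  count-delete {i} {v} i≢v (x ∷ w) with x ≟ v
  ... | yes refl = trans (cong (count i) (delete-here v w))
    (trans (count-delete i≢v w) (sym (count-there (i≢v ∘ sym) w)))
  ... | no x≢v = trans (cong (count i) (delete-there x≢v w)) (step (x ≟ i))
    where
    step : Dec (x ≡ i) → count i (x ∷ delete v w) ≡ count i (x ∷ w)
    step (yes refl) = trans (count-here x (delete v w))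
      (trans (cong suc (count-delete i≢v w)) (sym (count-here x w)))
    step (no x≢i) = trans (count-there x≢i (delete v w))
      (trans (count-delete i≢v w) (sym (count-there x≢i w)))

  -- Inserting copies of a new smallest letter

  when : {P : Set} → Dec P → List A → List A
  when (yes _) xs = xs
  when (no  _) xs = []

  -- The words obtained from u by inserting k copies of v,
  -- each placed at the end or in front of a letter not exceeding T.

  insertions : (T v k : ℕ) → List ℕ → List (List ℕ)
  insertions T v zero    u       = u ∷ []
  insertions T v (suc k) []      = map (v ∷_) (insertions T v k [])
  insertions T v (suc k) (x ∷ u) =
    when (x ≤? T) (map (v ∷_) (insertions T v k (x ∷ u))) ++ map (x ∷_) (insertions T v (suc k) u)

  -- Membership in `insertions` in a form that allows induction on the inserted word. `keep` asks
  -- for remaining copies, so that `done` is the only rule at `k = 0`.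
  data Insertion (T v : ℕ) : ℕ → List ℕ → List ℕ → Set where
    done : ∀ {u} → Insertion T v 0 u u
    last : ∀ {k w} → Insertion T v k [] w → Insertion T v (suc k) [] (v ∷ w)
    put  : ∀ {k x u w} → x ≤ T → Insertion T v k (x ∷ u) w → Insertion T v (suc k) (x ∷ u) (v ∷ w)
    keep : ∀ {k x u w} → Insertion T v (suc k) u w → Insertion T v (suc k) (x ∷ u) (x ∷ w)

  module _ {T v : ℕ} where

    insertions⁻ : ∀ k u {w} → w ∈ insertions T v k u → Insertion T v k u w
    insertions⁻ zero    u  (here refl) = done
    insertions⁻ (suc k) [] w∈ with ∈-map⁻ (v ∷_) w∈
    ... | _ , p , refl = last (insertions⁻ k [] p)
    insertions⁻ (suc k) (x ∷ u) w∈ with x ≤? T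
    ... | no _ with ∈-map⁻ (x ∷_) w∈
    ...   | _ , p , refl = keep (insertions⁻ (suc k) u p)
    insertions⁻ (suc k) (x ∷ u) w∈ | yes x≤T with ∈-++⁻ (map (v ∷_) (insertions T v k (x ∷ u))) w∈
    ... | inj₁ w∈₁ with ∈-map⁻ (v ∷_) w∈₁
    ...   | _ , p , refl = put x≤T (insertions⁻ k (x ∷ u) p)
    insertions⁻ (suc k) (x ∷ u) w∈ | yes x≤T | inj₂ w∈₂ with ∈-map⁻ (x ∷_) w∈₂
    ...   | _ , p , refl = keep (insertions⁻ (suc k) u p)

    insertions⁺ : ∀ {k u w} → Insertion T v k u w → w ∈ insertions T v k u
    insertions⁺ done     = here refl
    insertions⁺ (last p) = ∈-map⁺ (v ∷_) (insertions⁺ p)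
    insertions⁺ (put {x = x} x≤T p) with x ≤? T
    ... | yes _   = ∈-++⁺ˡ (∈-map⁺ (v ∷_) (insertions⁺ p))
    ... | no  x≰T = contradiction x≤T x≰T
    insertions⁺ (keep {k} {x} {u} p) with x ≤? T
    ... | yes _ = ∈-++⁺ʳ (map (v ∷_) (insertions T v k (x ∷ u))) (∈-map⁺ (x ∷_) (insertions⁺ p))
    ... | no  _ = ∈-map⁺ (x ∷_) (insertions⁺ p)

    -- The two halves of `insertions` begin with different letters, `v` and `x > v`.
    insertions-unique : ∀ k u → All (v <_) u → Unique (insertions T v k u)
    insertions-unique zero    u  _ = [] ∷ []
    insertions-unique (suc k) [] _ = Uniq.map⁺ (λ { refl → refl }) (insertions-unique k [] [])
    insertions-unique (suc k) (x ∷ u) (v<x ∷ v<u) with x ≤? T | insertions-unique k (x ∷ u) (v<x ∷ v<u)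
    ... | no  _ | _ = Uniq.map⁺ (λ { refl → refl }) (insertions-unique (suc k) u v<u)
    ... | yes _ | ih = Uniq.++⁺
      (Uniq.map⁺ (λ { refl → refl }) ih)
      (Uniq.map⁺ (λ { refl → refl }) (insertions-unique (suc k) u v<u))
      disjoint
      where
      disjoint : ∀ {w} → w ∈ map (v ∷_) (insertions T v k (x ∷ u)) × w ∈ map (x ∷_) (insertions T v (suc k) u) → _
      disjoint (p , q) with ∈-map⁻ (v ∷_) p | ∈-map⁻ (x ∷_) q
      ... | _ , _ , refl | _ , _ , refl = <-irrefl refl v<x

    -- The places are those before the `small T u` admissible letters and the end, and several
    -- copies may share a place, so multisets of places are counted. Whether a copy comes first or
    -- `x` does is Pascal's rule.
    insertions-length : ∀ k u → length (insertions T v k u) ≡ (k + small T u) C k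
    insertions-length zero    u  = refl
    insertions-length (suc k) [] = begin
      length (map (v ∷_) (insertions T v k [])) ≡⟨ length-map (v ∷_) (insertions T v k []) ⟩
      length (insertions T v k [])              ≡⟨ insertions-length k [] ⟩
      (k + 0) C k                               ≡⟨ cong (_C k) (+-identityʳ k) ⟩
      k C k                                     ≡⟨ nCn≡1 k ⟩
      1                                         ≡⟨ nCn≡1 (suc k) ⟨
      suc k C suc k                             ≡⟨ cong (_C suc k) (+-identityʳ (suc k)) ⟨
      (suc k + 0) C suc k                       ∎
      where open ≡-Reasoning
    insertions-length (suc k) (x ∷ u) with x ≤? T | insertions-length k (x ∷ u)
    ... | no x≰T  | _ = trans (length-map (x ∷_) (insertions T v (suc k) u))
      (trans (insertions-length (suc k) u) (cong (λ s → (suc k + s) C suc k) (sym (small-reject x≰T u))))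
    ... | yes x≤T | ih = begin
      length (map (v ∷_) I₁ ++ map (x ∷_) I₂)
        ≡⟨ length-++ (map (v ∷_) I₁) ⟩
      length (map (v ∷_) I₁) + length (map (x ∷_) I₂)
        ≡⟨ cong₂ _+_ (trans (length-map (v ∷_) I₁) ih) (trans (length-map (x ∷_) I₂) (insertions-length (suc k) u)) ⟩
      (k + small T (x ∷ u)) C k + suc (k + small T u) C suc k
        ≡⟨ cong (λ t → (k + small T (x ∷ u)) C k + t C suc k)
             (trans (sym (+-suc k (small T u))) (cong (k +_) (sym (small-accept x≤T u)))) ⟩
      (k + small T (x ∷ u)) C k + (k + small T (x ∷ u)) C suc k
        ≡⟨ nCk+nC[k+1]≡[n+1]C[k+1] (k + small T (x ∷ u)) k ⟩
      suc (k + small T (x ∷ u)) C suc k ∎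
      where
      open ≡-Reasoning
      I₁ = insertions T v k (x ∷ u)
      I₂ = insertions T v (suc k) u

    delete-insertion : ∀ {k u w} → All (v <_) u → Insertion T v k u w → delete v w ≡ u
    delete-insertion v<u done = delete-all _ v<u
    delete-insertion v<u (last {w = w} p)   = trans (delete-here v w) (delete-insertion v<u p)
    delete-insertion v<u (put {w = w} _ p)  = trans (delete-here v w) (delete-insertion v<u p)
    delete-insertion (v<x ∷ v<u) (keep {w = w} p) =
      trans (delete-there (>⇒≢ v<x) w) (cong (_ ∷_) (delete-insertion v<u p))

    count-insertion : ∀ {k u w} → All (v <_) u → Insertion T v k u w → count v w ≡ k
    count-insertion v<u done = count-none _ (All.map >⇒≢ v<u)
    count-insertion v<u (last {w = w} p)  = trans (count-here v w) (cong suc (count-insertion v<u p))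
    count-insertion v<u (put {w = w} _ p) = trans (count-here v w) (cong suc (count-insertion v<u p))
    count-insertion (v<x ∷ v<u) (keep {w = w} p) =
      trans (count-there (>⇒≢ v<x) w) (count-insertion v<u p)

    -- Letters of one block share `T`, so the copies just inserted are themselves places for the
    -- next smaller letter. This is how the binomials combine into a multinomial.
    small-insertion : ∀ {k u w} → v ≤ T → Insertion T v k u w → small T w ≡ k + small T u
    small-insertion v≤T done = refl
    small-insertion v≤T (last {w = w} p) =
      trans (small-accept v≤T w) (cong suc (small-insertion v≤T p))
    small-insertion v≤T (put {w = w} x≤T p) =
      trans (small-accept v≤T w) (cong suc (small-insertion v≤T p))
    small-insertion v≤T (keep {k} {x} {u} {w} p) with x ≤? T
    ... | yes x≤T = trans (small-accept x≤T w) (trans (cong suc (small-insertion v≤T p))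
      (trans (sym (+-suc (suc k) (small T u))) (cong (suc k +_) (sym (small-accept x≤T u)))))
    ... | no x≰T  = trans (small-reject x≰T w)
      (trans (small-insertion v≤T p) (cong (suc k +_) (sym (small-reject x≰T u))))

    ≤-insertion : ∀ {k u w} → All (v <_) u → Insertion T v k u w → All (v ≤_) w
    ≤-insertion v<u done      = All.map <⇒≤ v<u
    ≤-insertion v<u (last p)  = ≤-refl ∷ ≤-insertion v<u p
    ≤-insertion v<u (put _ p) = ≤-refl ∷ ≤-insertion v<u p
    ≤-insertion (v<x ∷ v<u) (keep p) = <⇒≤ v<x ∷ ≤-insertion v<u p

  delete-< : ∀ {v} w → All (v ≤_) w → All (v <_) (delete v w)
  delete-< []      []          = []
  delete-< {v} (x ∷ w) (v≤x ∷ v≤w) with x ≟ v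
  ... | yes refl = subst (All (v <_)) (sym (delete-here v w)) (delete-< w v≤w)
  ... | no x≢v   = subst (All (v <_)) (sym (delete-there x≢v w)) (≤∧≢⇒< v≤x (x≢v ∘ sym) ∷ delete-< w v≤w)

  -- Chains, the words that satisfy the singleton condition

  module _ (m : ℕ) .{{_ : NonZero m}} where

    -- The least multiple of `m` strictly above `a`, and the largest letter that may follow `a`.
    next : ℕ → ℕ
    next a = suc (a / m) * m

    next-mono : ∀ {a b} → a ≤ b → next a ≤ next b
    next-mono a≤b = *-monoˡ-≤ m (s≤s (/-monoˡ-≤ m a≤b))

    Chain : ℕ → List ℕ → Set
    Chain b []      = ⊤
    Chain b (x ∷ w) = x ≤ b × Chain (next x) w

    Chain-mono : ∀ {b b′} → b ≤ b′ → ∀ w → Chain b w → Chain b′ w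
    Chain-mono b≤b′ []      _       = tt
    Chain-mono b≤b′ (x ∷ w) (p , c) = ≤-trans p b≤b′ , c

    module _ {T v : ℕ} (v≤T : v ≤ T) (T≡ : T ≡ next v) where

      -- After an inserted `v` the bound is `T`, which the following letter respects. The copy
      -- itself always fits, since every bound met is at least `T`: a larger letter has a `next` no
      -- smaller than that of `v`.
      Chain-insertion : ∀ {k b u w} → T ≤ b → All (v <_) u → Insertion T v k u w → Chain b u → Chain b w
      Chain-insertion T≤b v<u done      c = c
      Chain-insertion T≤b v<u (last p)  c =
        ≤-trans v≤T T≤b , Chain-insertion (≤-reflexive T≡) v<u p tt
      Chain-insertion T≤b v<u (put x≤T p) (_ , c) =
        ≤-trans v≤T T≤b , Chain-insertion (≤-reflexive T≡) v<u p (≤-trans x≤T (≤-reflexive T≡) , c)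
      Chain-insertion T≤b (v<x ∷ v<u) (keep p) (x≤b , c) =
        x≤b , Chain-insertion (≤-trans (≤-reflexive T≡) (next-mono (<⇒≤ v<x))) v<u p c

      -- The letter after a deleted `v` was at most `T`, and the bound it now has to meet, inherited
      -- from what precedes `v`, is at least `T`.
      Chain-delete : ∀ {b} → T ≤ b → ∀ w → All (v ≤_) w → Chain b w → Chain b (delete v w)
      Chain-delete T≤b []      _           _ = tt
      Chain-delete T≤b (x ∷ w) (v≤x ∷ v≤w) (x≤b , c) with x ≟ v
      ... | yes refl = subst (Chain _) (sym (delete-here v w)) (Chain-mono T≤b (delete v w)
        (Chain-delete ≤-refl w v≤w (Chain-mono (≤-reflexive (sym T≡)) w c)))
      ... | no x≢v   = subst (Chain _) (sym (delete-there x≢v w))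
        (x≤b , Chain-delete (≤-trans (≤-reflexive T≡) (next-mono v≤x)) w v≤w c)

      -- Converse of `delete-insertion`. By `Chain-delete` the first surviving letter after a copy
      -- of `v` is at most `T`, so the copy stands at an admissible place.
      insertion-delete : ∀ {b} → T ≤ b → ∀ w → All (v ≤_) w → Chain b w →
        Insertion T v (count v w) (delete v w) w
      insertion-delete T≤b []      _           _ = done
      insertion-delete T≤b (x ∷ w) (v≤x ∷ v≤w) (x≤b , c) with x ≟ v
      ... | yes refl = subst₂ (λ k u → Insertion T v k u (v ∷ w))
        (sym (count-here v w)) (sym (delete-here v w))
        (front (Chain-delete ≤-refl w v≤w c′) (insertion-delete ≤-refl w v≤w c′))
        where
        c′ = Chain-mono (≤-reflexive (sym T≡)) w c
        front : ∀ {k u} → Chain T u → Insertion T v k u w → Insertion T v (suc k) u (v ∷ w)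
        front {u = []}    _         p = last p
        front {u = _ ∷ _} (x≤T , _) p = put x≤T p
      ... | no x≢v   = subst₂ (λ k u → Insertion T v k u (x ∷ w))
        (sym (count-there x≢v w)) (sym (delete-there x≢v w))
        (back (insertion-delete (≤-trans (≤-reflexive T≡) (next-mono v≤x)) w v≤w c))
        where
        back : ∀ {k u} → Insertion T v k u w → Insertion T v k (x ∷ u) (x ∷ w)
        back {zero}  done = done
        back {suc k} p    = keep p

    -- Words with prescribed letter counts

    module _ (n : ℕ → ℕ) where

      -- The multiplicity `k` of the lowest letter is kept apart from `n v`, because one copy of the
      -- letter that opens a block is held back for the front.
      record Word (T v k : ℕ) (w : List ℕ) : Set where
        constructor word
        field
          letters : All (v ≤_) w
          chain   : Chain T w
          lowest  : count v w ≡ k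
          above   : ∀ i → v < i → count i w ≡ n i
      open Word

      insertAll : (T v k : ℕ) → List (List ℕ) → List (List ℕ)
      insertAll T v k = concatMap (insertions T v k)

      -- Deleting `v` gives the only word on larger letters from which a word can arise, and it
      -- preserves the bound `T`.
      insertAll-enumerates : ∀ {T v k L} → v ≤ T → T ≡ next v →
        Enumerates (Word T (suc v) (n (suc v))) L → Enumerates (Word T v k) (insertAll T v k L)
      insertAll-enumerates {T} {v} {k} {L} v≤T T≡ (uL , ∈L) =
        concatMap-unique (delete v) L uL
          (λ {u} u∈L → insertions-unique k u (letters (∈⇒ u∈L)))
          (λ {u} u∈L w∈ → delete-insertion (letters (∈⇒ u∈L)) (insertions⁻ k u w∈))
        , λ w → mk⇔ to from
        where
        ∈⇒ : ∀ {u} → u ∈ L → Word T (suc v) (n (suc v)) u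
        ∈⇒ {u} = Equivalence.to (∈L u)
        to : ∀ {w} → w ∈ insertAll T v k L → Word T v k w
        to {w} w∈ with find (∈-concatMap⁻ (insertions T v k) w∈)
        ... | u , u∈L , w∈u with ∈⇒ u∈L | insertions⁻ k u w∈u
        ...   | word l c lo ab | p = word (≤-insertion l p) (Chain-insertion v≤T T≡ ≤-refl l p c)
          (count-insertion l p) above′
          where
          above′ : ∀ i → v < i → count i w ≡ n i
          above′ i v<i = begin
            count i w            ≡⟨ count-delete (>⇒≢ v<i) w ⟨
            count i (delete v w) ≡⟨ cong (count i) (delete-insertion l p) ⟩
            count i u            ≡⟨ u-counts (m≤n⇒m<n∨m≡n v<i) ⟩
            n i                  ∎
            where
            open ≡-Reasoning
            u-counts : _ → count i u ≡ n i
            u-counts (inj₁ sv<i) = ab i sv<i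
            u-counts (inj₂ refl) = lo
        from : ∀ {w} → Word T v k w → w ∈ insertAll T v k L
        from {w} (word l c refl ab) = ∈-concatMap⁺ (insertions T v k)
          (lose (Equivalence.from (∈L (delete v w))
                  (word (delete-< w l) (Chain-delete v≤T T≡ ≤-refl w l c) (counts (suc v) ≤-refl)
                    λ i sv<i → counts i (<⇒≤ sv<i)))
                (insertions⁺ (insertion-delete v≤T T≡ ≤-refl w l c)))
          where
          counts : ∀ i → v < i → count i (delete v w) ≡ n i
          counts i v<i = trans (count-delete (>⇒≢ v<i) w) (ab i v<i)

      insertAll-small : ∀ {T v k L s} → v ≤ T → (∀ {u} → u ∈ L → small T u ≡ s) →
        ∀ {w} → w ∈ insertAll T v k L → small T w ≡ k + s
      insertAll-small {T} {v} {k} v≤T h w∈ with find (∈-concatMap⁻ (insertions T v k) w∈)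
      ... | u , u∈L , w∈u = trans (small-insertion v≤T (insertions⁻ k u w∈u)) (cong (k +_) (h u∈L))

      insertAll-length : ∀ {T v k L s} → (∀ {u} → u ∈ L → small T u ≡ s) →
        length (insertAll T v k L) ≡ ((k + s) C k) * length L
      insertAll-length {T} {v} {k} {L} {s} h = concatMap-length (insertions T v k) ((k + s) C k) L
        (λ {u} u∈L → trans (insertions-length k u) (cong (λ t → (k + t) C k) (h u∈L)))

  small-≥ : ∀ {T} w → All (T ≤_) w → small T w ≡ count T w
  small-≥ []      []          = refl
  small-≥ {T} (x ∷ w) (T≤x ∷ T≤w) with x ≟ T
  ... | yes refl = trans (small-accept ≤-refl w) (trans (cong suc (small-≥ w T≤w)) (sym (count-here x w)))
  ... | no x≢T   = trans (small-reject (λ x≤T → x≢T (≤-antisym x≤T T≤x)) w)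
    (trans (small-≥ w T≤w) (sym (count-there x≢T w)))

  -- The letters of one block

  module _ (m : ℕ) .{{_ : NonZero m}} where

    next-block : ∀ i {r} → r < m → next m (i * m + r) ≡ suc i * m
    next-block i {r} r<m = cong (λ q → suc q * m) (begin
      (i * m + r) / m     ≡⟨ +-distrib-/-∣ˡ r (divides-refl i) ⟩
      i * m / m + r / m   ≡⟨ cong₂ _+_ (m*n/n≡m i m) (m<n⇒m/n≡0 r<m) ⟩
      i + 0               ≡⟨ +-identityʳ i ⟩
      i                   ∎)
      where open ≡-Reasoning

    <-next : ∀ a → a < next m a
    <-next a = begin-strict
      a                    ≡⟨ m≡m%n+[m/n]*n a m ⟩
      a % m + a / m * m    <⟨ +-monoˡ-< (a / m * m) (m%n<n a m) ⟩
      m + a / m * m        ∎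
      where open ≤-Reasoning

    module _ (n : ℕ → ℕ) where

      -- ℓ 0, …, ℓ d = T are consecutive letters of one block; L holds the words on the letters from T on.
      extend : (T : ℕ) (ℓ : ℕ → ℕ) (d : ℕ) → List (List ℕ) → List (List ℕ)
      extend T ℓ zero    L = L
      extend T ℓ (suc d) L = insertAll m n T (ℓ 0) (n (ℓ 0)) (extend T (ℓ ∘ suc) d L)

      module _ {T : ℕ} {L : List (List ℕ)} (enum : Enumerates (Word m n T T (n T)) L) where

        extend-enumerates : ∀ ℓ d → (∀ j → ℓ (suc j) ≡ suc (ℓ j)) → (∀ {j} → j < d → next m (ℓ j) ≡ T) →
          ℓ d ≡ T → Enumerates (Word m n T (ℓ 0) (n (ℓ 0))) (extend T ℓ d L)
        extend-enumerates ℓ zero    ℓ-suc ℓ-next refl = enum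
        extend-enumerates ℓ (suc d) ℓ-suc ℓ-next ℓd≡T = insertAll-enumerates m n
          (≤-trans (<⇒≤ (<-next (ℓ 0))) (≤-reflexive (ℓ-next z<s))) (sym (ℓ-next z<s))
          (subst (λ v → Enumerates (Word m n T v (n v)) (extend T (ℓ ∘ suc) d L)) (ℓ-suc 0)
            (extend-enumerates (ℓ ∘ suc) d (ℓ-suc ∘ suc) (ℓ-next ∘ s<s) ℓd≡T))

        -- Among the letters of `L` only the copies of `T` are at most `T`; to these come all
        -- letters of the block inserted so far.
        extend-small : ∀ ℓ d → (∀ {j} → j < d → next m (ℓ j) ≡ T) → ℓ d ≡ T →
          ∀ {w} → w ∈ extend T ℓ d L → small T w ≡ sum (applyUpTo (n ∘ ℓ) (suc d))
        extend-small ℓ zero ℓ-next refl {w} w∈ with Equivalence.to (proj₂ enum w) w∈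
        ... | word l _ lo _ = trans (small-≥ w l) (trans lo (sym (+-identityʳ (n T))))
        extend-small ℓ (suc d) ℓ-next ℓd≡T =
          insertAll-small m n {k = n (ℓ 0)} (≤-trans (<⇒≤ (<-next (ℓ 0))) (≤-reflexive (ℓ-next z<s)))
            (extend-small (ℓ ∘ suc) d (ℓ-next ∘ s<s) ℓd≡T)

        -- Each letter contributes the binomial that `multinomial` splits off. The last entry
        -- belongs to `T`, whose copies are already in `L`; its binomial is 1.
        extend-length : ∀ ℓ d → (∀ {j} → j < d → next m (ℓ j) ≡ T) → ℓ d ≡ T →
          length (extend T ℓ d L) ≡ multinomial (applyUpTo (n ∘ ℓ) (suc d)) * length L
        extend-length ℓ zero ℓ-next refl = sym (begin
          ((n T + 0) C n T) * 1 * length L ≡⟨ cong (_* length L) (*-identityʳ ((n T + 0) C n T)) ⟩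
          ((n T + 0) C n T) * length L     ≡⟨ cong (λ t → (t C n T) * length L) (+-identityʳ (n T)) ⟩
          (n T C n T) * length L           ≡⟨ cong (_* length L) (nCn≡1 (n T)) ⟩
          1 * length L                     ≡⟨ *-identityˡ (length L) ⟩
          length L                         ∎)
          where open ≡-Reasoning
        extend-length ℓ (suc d) ℓ-next ℓd≡T = begin
          length (insertAll m n T (ℓ 0) (n (ℓ 0)) (extend T (ℓ ∘ suc) d L))
            ≡⟨ insertAll-length m n {v = ℓ 0} {n (ℓ 0)} (extend-small (ℓ ∘ suc) d (ℓ-next ∘ s<s) ℓd≡T) ⟩
          c * length (extend T (ℓ ∘ suc) d L)
            ≡⟨ cong (c *_) (extend-length (ℓ ∘ suc) d (ℓ-next ∘ s<s) ℓd≡T) ⟩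
          c * (multinomial ks * length L)
            ≡⟨ *-assoc c (multinomial ks) (length L) ⟨
          c * multinomial ks * length L ∎
          where
          open ≡-Reasoning
          ks = applyUpTo (n ∘ ℓ ∘ suc) (suc d)
          c  = (n (ℓ 0) + sum ks) C n (ℓ 0)

      -- A first letter would be squeezed to `v` itself. So without `v` no larger letter can occur
      -- either, which explains the value 0 in `blockFactor`.
      empty-word : ∀ {v w} → Word m n v v 0 w → w ≡ []
      empty-word {w = []}    _ = refl
      empty-word {v} {x ∷ w} (word (v≤x ∷ _) (x≤v , _) lo _) with ≤-antisym x≤v v≤x
      ... | refl = contradiction (trans (sym lo) (count-here v w)) λ ()

      -- The bound `v` forces the first letter to be `v`. The rest is a chain with bound `T` that
      -- contains the other `k` copies at arbitrary admissible places.
      initial-enumerates : ∀ {T v k L} → v ≤ T → T ≡ next m v →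
        Enumerates (Word m n T (suc v) (n (suc v))) L →
        Enumerates (Word m n v v (suc k)) (map (v ∷_) (insertAll m n T v k L))
      initial-enumerates {T} {v} {k} {L} v≤T T≡ enum
        with insertAll-enumerates m n {k = k} v≤T T≡ enum
      ... | uI , ∈I = Uniq.map⁺ (λ { refl → refl }) uI , λ w → mk⇔ to (from w)
        where
        to : ∀ {w} → w ∈ map (v ∷_) (insertAll m n T v k L) → Word m n v v (suc k) w
        to w∈ with ∈-map⁻ (v ∷_) w∈
        ... | w , w∈I , refl with Equivalence.to (∈I w) w∈I
        ...   | word l c lo ab = word (≤-refl ∷ l) (≤-refl , subst (λ b → Chain m b w) T≡ c)
          (trans (count-here v w) (cong suc lo)) (λ i v<i → trans (count-there (<⇒≢ v<i) w) (ab i v<i))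
        from : ∀ w → Word m n v v (suc k) w → w ∈ map (v ∷_) (insertAll m n T v k L)
        from []      (word _ _ () _)
        from (x ∷ w) (word (v≤x ∷ l) (x≤v , c) lo ab) with ≤-antisym x≤v v≤x
        ... | refl = ∈-map⁺ (v ∷_) (Equivalence.from (∈I w)
          (word l (subst (λ b → Chain m b w) (sym T≡) c)
            (suc-injective (trans (sym (count-here v w)) lo))
            (λ i v<i → trans (sym (count-there (<⇒≢ v<i) w)) (ab i v<i))))

  sum≡0⇒ : ∀ f d → sum (applyUpTo f d) ≡ 0 → ∀ {j} → j < d → f j ≡ 0
  sum≡0⇒ f (suc d) s≡0 {zero}  _         = m+n≡0⇒m≡0 (f 0) s≡0
  sum≡0⇒ f (suc d) s≡0 {suc j} (s≤s j<d) = sum≡0⇒ (f ∘ suc) d (m+n≡0⇒n≡0 (f 0) s≡0) j<d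

  sum-zeros : ∀ f d → (∀ j → f j ≡ 0) → sum (applyUpTo f d) ≡ 0
  sum-zeros f zero    f≡0 = refl
  sum-zeros f (suc d) f≡0 = cong₂ _+_ (f≡0 0) (sum-zeros (f ∘ suc) d (f≡0 ∘ suc))

  -- Assembling the blocks

  module _ (d : ℕ) (n : ℕ → ℕ) where

    private
      m = suc d

    letter : ℕ → ℕ → ℕ
    letter i j = i * m + suc j

    -- Without the letter `i * m` only the empty word is possible, so the other letters of the block
    -- have to be absent as well.
    block : ℕ → List (List ℕ) → List (List ℕ)
    block i L with n (i * m)
    ... | zero  = when (sum (applyUpTo (n ∘ letter i) m) ≟ 0) L
    ... | suc k = map (i * m ∷_) (insertAll m n (suc i * m) (i * m) k (extend m n (suc i * m) (letter i) d L))

    module _ (i : ℕ) {L : List (List ℕ)}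
             (enum : Enumerates (Word m n (suc i * m) (suc i * m) (n (suc i * m))) L) where

      private
        v = i * m
        T = suc i * m

        ℓ-next : ∀ {j} → j < d → next m (letter i j) ≡ T
        ℓ-next j<d = next-block m i (s<s j<d)

        ℓd≡T : letter i d ≡ T
        ℓd≡T = +-comm v m

        v≤T : v ≤ T
        v≤T = m≤n+m v m

        T≡ : T ≡ next m v
        T≡ = trans (sym (next-block m i z<s)) (cong (next m) (+-identityʳ v))

      block-enumerates : Enumerates (Word m n v v (n v)) (block i L)
      block-enumerates with n v in nv
      ... | suc k = initial-enumerates m n v≤T T≡
        (subst (λ u → Enumerates (Word m n T u (n u)) (extend m n T (letter i) d L))
          (trans (+-suc v 0) (cong suc (+-identityʳ v)))
          (extend-enumerates m n enum (letter i) d (λ j → +-suc v (suc j)) ℓ-next ℓd≡T))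
      ... | zero with sum (applyUpTo (n ∘ letter i) m) ≟ 0
      ...   | no s≢0 = [] , λ w → mk⇔ (λ ()) λ p → contradiction (from w p (empty-word m n p)) s≢0
        where
        from : ∀ w → Word m n v v 0 w → w ≡ [] → sum (applyUpTo (n ∘ letter i) m) ≡ 0
        from w (word _ _ _ ab) refl = sum-zeros (n ∘ letter i) m
          (λ j → sym (ab (letter i j) (m<m+n v z<s)))
      -- `T` is the last letter of the block and thus absent too, so `L` contains at most the empty
      -- word.
      ...   | yes s≡0 = proj₁ enum , λ w → mk⇔
          (λ w∈ → up w (Equivalence.to (proj₂ enum w) w∈))
          (λ p → Equivalence.from (proj₂ enum w) (down w p (empty-word m n p)))
        where
        nT≡0 : n T ≡ 0
        nT≡0 = trans (cong n (sym ℓd≡T)) (sum≡0⇒ (n ∘ letter i) m s≡0 (n<1+n d))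
        down : ∀ w → Word m n v v 0 w → w ≡ [] → Word m n T T (n T) w
        down w (word _ _ _ ab) refl = word [] tt (sym nT≡0) (λ i T<i → ab i (≤-<-trans v≤T T<i))
        up : ∀ w → Word m n T T (n T) w → Word m n v v 0 w
        up w p with empty-word m n (subst (λ k → Word m n T T k w) nT≡0 p)
        up w (word _ _ lo ab) | refl = word [] tt refl above
          where
          above : ∀ j → v < j → 0 ≡ n j
          above j v<j with <-cmp j T
          ... | tri> _ _ T<j = ab j T<j
          ... | tri≈ _ refl _ = sym nT≡0
          ... | tri< j<T _ _ with m≤n⇒∃[o]m+o≡n v<j
          ...   | o , refl = sym (trans (cong n (sym (+-suc v o)))
            (sum≡0⇒ (n ∘ letter i) m s≡0 (+-cancelˡ-< v o m
              (≤-<-trans (n≤1+n (v + o)) (<-≤-trans j<T (≤-reflexive (+-comm m v)))))))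

      block-length : length (block i L) ≡ factor m n i * length L
      block-length with n v
      ... | zero with sum (applyUpTo (n ∘ letter i) m) ≟ 0
      ...   | no  _ = refl
      ...   | yes _ = sym (*-identityˡ (length L))
      block-length | suc k = begin
        length (map (v ∷_) (insertAll m n T v k E))
          ≡⟨ length-map (v ∷_) (insertAll m n T v k E) ⟩
        length (insertAll m n T v k E)
          ≡⟨ insertAll-length m n {v = v} {k} (extend-small m n enum (letter i) d ℓ-next ℓd≡T) ⟩
        c * length E
          ≡⟨ cong (c *_) (extend-length m n enum (letter i) d ℓ-next ℓd≡T) ⟩
        c * (multinomial ks * length L)
          ≡⟨ *-assoc c (multinomial ks) (length L) ⟨
        c * multinomial ks * length L ∎
        where
        open ≡-Reasoning
        E  = extend m n T (letter i) d L
        ks = applyUpTo (n ∘ letter i) m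
        c  = (k + sum ks) C k

    words : (i N : ℕ) → List (List ℕ)
    words i zero    = [] ∷ []
    words i (suc N) = block i (words (suc i) N)

    -- From `(i + N) * m` on no letter occurs, so the recursion may stop there with the empty word.
    words-enumerates : ∀ i N → (∀ j → (i + N) * m ≤ j → n j ≡ 0) →
      Enumerates (Word m n (i * m) (i * m) (n (i * m))) (words i N)
    words-enumerates i zero n≡0 = [] ∷ [] , λ w → mk⇔ to (from w)
      where
      n≡0′ : ∀ j → i * m ≤ j → n j ≡ 0
      n≡0′ j i*m≤j = n≡0 j (≤-trans (≤-reflexive (cong (_* m) (+-identityʳ i))) i*m≤j)
      to : ∀ {w} → w ∈ [] ∷ [] → Word m n (i * m) (i * m) (n (i * m)) w
      to (here refl) = word [] tt (sym (n≡0′ (i * m) ≤-refl)) (λ j i*m<j → sym (n≡0′ j (<⇒≤ i*m<j)))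
      from : ∀ w → Word m n (i * m) (i * m) (n (i * m)) w → w ∈ [] ∷ []
      from w p = here (empty-word m n (subst (λ k → Word m n (i * m) (i * m) k w) (n≡0′ (i * m) ≤-refl) p))
    words-enumerates i (suc N) n≡0 = block-enumerates i (words-enumerates (suc i) N
      (λ j → n≡0 j ∘ ≤-trans (≤-reflexive (cong (_* m) (+-suc i N)))))

    words-length : ∀ i N → (∀ j → (i + N) * m ≤ j → n j ≡ 0) →
      length (words i N) ≡ foldr _*_ 1 (applyUpTo (λ j → factor m n (i + j)) N)
    words-length i zero    n≡0 = refl
    words-length i (suc N) n≡0 = begin
      length (block i (words (suc i) N))
        ≡⟨ block-length i (words-enumerates (suc i) N n≡0′) ⟩
      factor m n i * length (words (suc i) N)
        ≡⟨ cong₂ _*_ (cong (factor m n) (sym (+-identityʳ i))) (words-length (suc i) N n≡0′) ⟩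
      factor m n (i + 0) * foldr _*_ 1 (applyUpTo (λ j → factor m n (suc i + j)) N)
        ≡⟨ cong (λ xs → factor m n (i + 0) * foldr _*_ 1 xs)
             (applyUpTo-cong (λ j → cong (factor m n) (sym (+-suc i j))) N) ⟩
      factor m n (i + 0) * foldr _*_ 1 (applyUpTo (λ j → factor m n (i + suc j)) N) ∎
      where
      open ≡-Reasoning
      n≡0′ : ∀ j → (suc i + N) * m ≤ j → n j ≡ 0
      n≡0′ j = n≡0 j ∘ ≤-trans (≤-reflexive (cong (_* m) (+-suc i N)))
      applyUpTo-cong : ∀ {f g : ℕ → ℕ} → (∀ j → f j ≡ g j) → ∀ N → applyUpTo f N ≡ applyUpTo g N
      applyUpTo-cong f≗g zero    = refl
      applyUpTo-cong f≗g (suc N) = cong₂ _∷_ (f≗g 0) (applyUpTo-cong (f≗g ∘ suc) N)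

  words-count : ∀ m .{{_ : NonZero m}} n N → (∀ j → N * m ≤ j → n j ≡ 0) →
    ∃ λ L → Enumerates (Word m n 0 0 (n 0)) L × length L ≡ prodUpTo N (factor m n)
  words-count (suc d) n N n≡0 = words d n 0 N , words-enumerates d n 0 N n≡0 ,
    trans (words-length d n 0 N n≡0) (cong (foldr _*_ 1) (sym (map-upTo (factor (suc d) n) N)))

-- The expansion of ∏ (x - a) in the basis x (x - m) ⋯ (x - (k - 1) m)

module Roots where

  open import Algebra.Properties.AbelianGroup ℤₚ.+-0-abelianGroup using () renaming (∙-cancelʳ to +-cancelʳ)
  open import Data.Integer using (ℤ; +_; 0ℤ; 1ℤ; _+_; _*_; _-_)

  module _ (m : ℕ) where

    -- Multiplication by `x - a` in the basis `falling`: `(x - a) * falling n x` equals `falling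
    -- (suc n) x + (n * m - a) * falling n x`, applied with `n = l - k`.
    expandStep : ℕ → ℤ → (ℕ → ℤ) → ℕ → ℤ
    expandStep l a R zero    = R zero
    expandStep l a R (suc k) = R (suc k) + ((+ l - + k) * + m - a) * R k

    -- coeff as k is the coefficient of falling (length as - k) in ∏ (x - a).
    coeff : List ℤ → ℕ → ℤ
    coeff []       zero    = 1ℤ
    coeff []       (suc k) = 0ℤ
    coeff (a ∷ as) = expandStep (length as) a (coeff as)

    expandStep-cong : ∀ l a {R R′} → R ≗ R′ → expandStep l a R ≗ expandStep l a R′
    expandStep-cong l a R≗R′ zero    = R≗R′ zero
    expandStep-cong l a R≗R′ (suc k) = cong₂ _+_ (R≗R′ (suc k)) (cong (((+ l - + k) * + m - a) *_) (R≗R′ k))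

    expandStep-swap : ∀ l a b R →
      expandStep (suc l) a (expandStep l b R) ≗ expandStep (suc l) b (expandStep l a R)
    expandStep-swap l a b R zero          = refl
    expandStep-swap l a b R (suc zero)    = identity (+ l) (+ m) a b (R 1) (R 0)
      where
      identity : ∀ l m a b R₁ R₀ →
        (R₁ + ((l - 0ℤ) * m - b) * R₀) + ((1ℤ + l - 0ℤ) * m - a) * R₀
        ≡ (R₁ + ((l - 0ℤ) * m - a) * R₀) + ((1ℤ + l - 0ℤ) * m - b) * R₀
      identity = solve-∀
    expandStep-swap l a b R (suc (suc k)) = identity (+ l) (+ k) (+ m) a b (R (2 ℕ.+ k)) (R (1 ℕ.+ k)) (R k)
      where
      identity : ∀ l k m a b R₂ R₁ R₀ →
        (R₂ + ((l - (1ℤ + k)) * m - b) * R₁) + ((1ℤ + l - (1ℤ + k)) * m - a) * (R₁ + ((l - k) * m - b) * R₀)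
        ≡ (R₂ + ((l - (1ℤ + k)) * m - a) * R₁) + ((1ℤ + l - (1ℤ + k)) * m - b) * (R₁ + ((l - k) * m - a) * R₀)
      identity = solve-∀

    coeff-↭ : ∀ {as bs} → as ↭ bs → coeff as ≗ coeff bs
    coeff-↭ Perm.refl k = refl
    coeff-↭ (Perm.prep {xs} {ys} a p) k = trans (expandStep-cong (length xs) a (coeff-↭ p) k)
      (cong (λ l → expandStep l a (coeff ys) k) (Permₚ.↭-length p))
    coeff-↭ (Perm.swap {xs} {ys} a b p) k = trans (expandStep-swap (length xs) a b (coeff xs) k)
      (trans (expandStep-cong (suc (length xs)) b (expandStep-cong (length xs) a (coeff-↭ p)) k)
        (cong (λ l → expandStep (suc l) b (expandStep l a (coeff ys)) k) (Permₚ.↭-length p)))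
    coeff-↭ (Perm.trans p q) k = trans (coeff-↭ p k) (coeff-↭ q k)

    coeff-vanishes : ∀ as {k} → length as ℕ.< k → coeff as k ≡ 0ℤ
    coeff-vanishes []       (s≤s _)           = refl
    coeff-vanishes (a ∷ as) {suc k} (s≤s l<k) = cong₂ _+_ (coeff-vanishes as (ℕₚ.m<n⇒m<1+n l<k))
      (trans (cong (c *_) (coeff-vanishes as l<k)) (ℤₚ.*-zeroʳ c))
      where c = (+ length as - + k) * + m - a

    -- Division by `x - a`: each `R (suc k)` enters with coefficient 1 and can be solved for once
    -- `R k` is known.
    expandStep-injective : ∀ l a {R R′} → expandStep l a R ≗ expandStep l a R′ → R ≗ R′
    expandStep-injective l a eq zero    = eq zero
    expandStep-injective l a {R} {R′} eq (suc k) = +-cancelʳ (c * R k) (R (suc k)) (R′ (suc k))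
      (trans (eq (suc k)) (cong (λ r → R′ (suc k) + c * r) (sym (expandStep-injective l a eq k))))
      where c = (+ l - + k) * + m - a

    -- Evaluation at a point, and recovering the roots

    falling : ℕ → ℤ → ℤ
    falling zero    x = 1ℤ
    falling (suc n) x = (x - + n * + m) * falling n x

    eval : ℕ → (ℕ → ℤ) → ℤ → ℤ
    eval zero    R x = R 0
    eval (suc n) R x = R 0 * falling (suc n) x + eval n (R ∘ suc) x

    evalTail : ℕ → (ℕ → ℤ) → ℤ → ℤ
    evalTail zero    R x = 0ℤ
    evalTail (suc n) R x = eval n (R ∘ suc) x

    eval-split : ∀ n R x → eval n R x ≡ R 0 * falling n x + evalTail n R x
    eval-split zero    R x = identity (R 0)
      where
      identity : ∀ r → r ≡ r * 1ℤ + 0ℤ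
      identity = solve-∀
    eval-split (suc n) R x = refl

    eval-cong : ∀ n {R R′} → R ≗ R′ → ∀ x → eval n R x ≡ eval n R′ x
    eval-cong zero    R≗R′ x = R≗R′ 0
    eval-cong (suc n) R≗R′ x = cong₂ _+_ (cong (_* falling (suc n) x) (R≗R′ 0)) (eval-cong n (R≗R′ ∘ suc) x)

    -- The evaluated sequence is the product with `x - a` stripped of its term of top degree. Hence
    -- the tail gains the full factor `x - a`, whereas the head `R 0` keeps only the constant
    -- `n * m - a`.
    eval-shifted : ∀ n a R x → R (suc n) ≡ 0ℤ →
      eval n (λ k → R (suc k) + ((+ n - + k) * + m - a) * R k) x
      ≡ (x - a) * evalTail n R x + (+ n * + m - a) * (R 0 * falling n x)
    eval-shifted zero a R x R₁≡0 = trans (cong (_+ ((0ℤ - 0ℤ) * + m - a) * R 0) R₁≡0) (identity (+ m) a x (R 0))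
      where
      identity : ∀ m a x r → 0ℤ + ((0ℤ - 0ℤ) * m - a) * r ≡ (x - a) * 0ℤ + (0ℤ * m - a) * (r * 1ℤ)
      identity = solve-∀
    eval-shifted (suc n) a R x Rₙ≡0 = begin
      (R 1 + ((+ suc n - 0ℤ) * + m - a) * R 0) * falling (suc n) x
        + eval n (λ k → R (2 ℕ.+ k) + ((+ suc n - + suc k) * + m - a) * R (suc k)) x
        ≡⟨ cong (_+_ h₀) (eval-cong n (λ k → shift (+ n) (+ k) (+ m) a (R (2 ℕ.+ k)) (R (suc k))) x) ⟩
      h₀ + eval n (λ k → R (2 ℕ.+ k) + ((+ n - + k) * + m - a) * R (suc k)) x
        ≡⟨ cong (_+_ h₀) (eval-shifted n a (R ∘ suc) x Rₙ≡0) ⟩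
      h₀ + ((x - a) * evalTail n (R ∘ suc) x + (+ n * + m - a) * (R 1 * falling n x))
        ≡⟨ identity (+ n) (+ m) a x (R 0) (R 1) (falling n x) (evalTail n (R ∘ suc) x) ⟩
      (x - a) * (R 1 * falling n x + evalTail n (R ∘ suc) x) + (+ suc n * + m - a) * (R 0 * falling (suc n) x)
        ≡⟨ cong (λ e → (x - a) * e + (+ suc n * + m - a) * (R 0 * falling (suc n) x)) (eval-split n (R ∘ suc) x) ⟨
      (x - a) * eval n (R ∘ suc) x + (+ suc n * + m - a) * (R 0 * falling (suc n) x) ∎
      where
      open ≡-Reasoning
      h₀ = (R 1 + ((+ suc n - 0ℤ) * + m - a) * R 0) * falling (suc n) x
      shift : ∀ n k m a r₂ r₁ →
        r₂ + ((1ℤ + n - (1ℤ + k)) * m - a) * r₁ ≡ r₂ + ((n - k) * m - a) * r₁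
      shift = solve-∀
      identity : ∀ n m a x r₀ r₁ f t →
        (r₁ + ((1ℤ + n - 0ℤ) * m - a) * r₀) * ((x - n * m) * f) + ((x - a) * t + (n * m - a) * (r₁ * f))
        ≡ (x - a) * (r₁ * f + t) + ((1ℤ + n) * m - a) * (r₀ * ((x - n * m) * f))
      identity = solve-∀

    rootProduct : ℤ → List ℤ → ℤ
    rootProduct x []       = 1ℤ
    rootProduct x (a ∷ as) = (x - a) * rootProduct x as

    eval-coeff : ∀ as x → eval (length as) (coeff as) x ≡ rootProduct x as
    eval-coeff []       x = refl
    eval-coeff (a ∷ as) x = begin
      R 0 * falling (suc l) x + eval l (λ k → R (suc k) + ((+ l - + k) * + m - a) * R k) x
        ≡⟨ cong (_+_ (R 0 * falling (suc l) x)) (eval-shifted l a R x (coeff-vanishes as (ℕₚ.n<1+n l))) ⟩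
      R 0 * falling (suc l) x + ((x - a) * evalTail l R x + (+ l * + m - a) * (R 0 * falling l x))
        ≡⟨ identity (+ l * + m) a x (R 0) (falling l x) (evalTail l R x) ⟩
      (x - a) * (R 0 * falling l x + evalTail l R x)
        ≡⟨ cong ((x - a) *_) (trans (sym (eval-split l R x)) (eval-coeff as x)) ⟩
      (x - a) * rootProduct x as ∎
      where
      open ≡-Reasoning
      l = length as
      R = coeff as
      identity : ∀ lm a x r f t →
        r * ((x - lm) * f) + ((x - a) * t + (lm - a) * (r * f)) ≡ (x - a) * (r * f + t)
      identity = solve-∀

    rootProduct≡0⇒∈ : ∀ x as → rootProduct x as ≡ 0ℤ → x ∈ as
    rootProduct≡0⇒∈ x (a ∷ as) eq with ℤₚ.i*j≡0⇒i≡0∨j≡0 (x - a) eq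
    ... | inj₁ x-a≡0 = here (ℤₚ.i-j≡0⇒i≡j x a x-a≡0)
    ... | inj₂ p≡0   = there (rootProduct≡0⇒∈ x as p≡0)

    -- Evaluation at the first root `a` makes the product over `bs` vanish, and the integers have no
    -- zero divisors, so `a` occurs in `bs`. Cancelling this factor on both sides leaves shorter
    -- lists.
    coeff-injective : ∀ as bs → length as ≡ length bs → coeff as ≗ coeff bs → as ↭ bs
    coeff-injective []       []       _  _  = Perm.refl
    coeff-injective (a ∷ as) bs l≡ eq with ∈-∃++ (rootProduct≡0⇒∈ a bs root)
      where
      open ≡-Reasoning
      root : rootProduct a bs ≡ 0ℤ
      root = begin
        rootProduct a bs                        ≡⟨ eval-coeff bs a ⟨
        eval (length bs) (coeff bs) a           ≡⟨ eval-cong (length bs) (sym ∘ eq) a ⟩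
        eval (length bs) (coeff (a ∷ as)) a     ≡⟨ cong (λ l → eval l (coeff (a ∷ as)) a) l≡ ⟨
        eval (length (a ∷ as)) (coeff (a ∷ as)) a ≡⟨ eval-coeff (a ∷ as) a ⟩
        (a - a) * rootProduct a as              ≡⟨ cong (_* rootProduct a as) (ℤₚ.i≡j⇒i-j≡0 {a} refl) ⟩
        0ℤ * rootProduct a as                   ≡⟨ ℤₚ.*-zeroˡ (rootProduct a as) ⟩
        0ℤ                                      ∎
    ... | ys , zs , refl = ↭-trans
      (Perm.prep a (coeff-injective as (ys ++ zs) l≡′ (expandStep-injective (length as) a eq′)))
      (↭-sym (Permₚ.shift a ys zs))
      where
      l≡′ : length as ≡ length (ys ++ zs)
      l≡′ = ℕₚ.suc-injective (trans l≡ (Permₚ.↭-length (Permₚ.shift a ys zs)))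
      eq′ : expandStep (length as) a (coeff as) ≗ expandStep (length as) a (coeff (ys ++ zs))
      eq′ k = trans (eq k) (trans (coeff-↭ (Permₚ.shift a ys zs) k)
        (cong (λ l → expandStep l a (coeff (ys ++ zs)) k) (sym l≡′)))

-- Rook numbers column by column

module Rooks where

  open import Data.Integer using (ℤ; +_; 0ℤ; 1ℤ; _+_; _*_; _-_)

  -- Counting with Boolean predicates

  ⌊⌋-true : {P : Set} (P? : Dec P) → P → ⌊ P? ⌋ ≡ true
  ⌊⌋-true P? p = trans (isYes≗does P?) (dec-true P? p)

  ⌊⌋-false : {P : Set} (P? : Dec P) → ¬ P → ⌊ P? ⌋ ≡ false
  ⌊⌋-false P? ¬p = trans (isYes≗does P?) (dec-false P? ¬p)

  bit : Bool → ℕ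
  bit b = if b then 1 else 0

  module _ {A : Set} where

    countᵇ : (A → Bool) → List A → ℕ
    countᵇ p xs = length (filterᵇ p xs)

    countᵇ-∷ : ∀ p x xs → countᵇ p (x ∷ xs) ≡ bit (p x) ℕ.+ countᵇ p xs
    countᵇ-∷ p x xs with p x
    ... | true  = refl
    ... | false = refl

    countᵇ-++ : ∀ p xs ys → countᵇ p (xs ++ ys) ≡ countᵇ p xs ℕ.+ countᵇ p ys
    countᵇ-++ p xs ys = trans (cong length (filter-++ (T? ∘ p) xs ys)) (length-++ (filterᵇ p xs))

    countᵇ-cong : ∀ {p q} → p ≗ q → ∀ xs → countᵇ p xs ≡ countᵇ q xs
    countᵇ-cong p≗q [] = refl
    countᵇ-cong {p} {q} p≗q (x ∷ xs) = trans (countᵇ-∷ p x xs)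
      (trans (cong₂ ℕ._+_ (cong bit (p≗q x)) (countᵇ-cong p≗q xs)) (sym (countᵇ-∷ q x xs)))

    countᵇ-map : ∀ p (f : A → A) xs → countᵇ p (map f xs) ≡ countᵇ (p ∘ f) xs
    countᵇ-map p f []       = refl
    countᵇ-map p f (x ∷ xs) = trans (countᵇ-∷ p (f x) (map f xs))
      (trans (cong (bit (p (f x)) ℕ.+_) (countᵇ-map p f xs)) (sym (countᵇ-∷ (p ∘ f) x xs)))

    countᵇ-false : (xs : List A) → countᵇ (λ _ → false) xs ≡ 0
    countᵇ-false []       = refl
    countᵇ-false (x ∷ xs) = countᵇ-false xs

    allB-∧ : ∀ (p q : A → Bool) xs → allB (λ x → p x ∧ q x) xs ≡ allB p xs ∧ allB q xs
    allB-∧ p q []       = refl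
    allB-∧ p q (x ∷ xs) with p x | q x
    ... | true  | true  = allB-∧ p q xs
    ... | true  | false = sym (∧-zeroʳ (allB p xs))
    ... | false | _     = refl

    allB-true : ∀ {p : A → Bool} {xs} → All (λ x → p x ≡ true) xs → allB p xs ≡ true
    allB-true []         = refl
    allB-true (px ∷ pxs) = cong₂ _∧_ px (allB-true pxs)

  -- The bit of 0 is added on the right, in step with `fitting` on a column.
  below : (ℕ → Bool) → ℕ → ℕ
  below p zero    = 0
  below p (suc c) = below (p ∘ suc) c ℕ.+ bit (p 0)

  below-+ : ∀ p a s → below p (a ℕ.+ s) ≡ below p a ℕ.+ below (λ r → p (a ℕ.+ r)) s
  below-+ p zero    s = refl
  below-+ p (suc a) s = begin
    below (p ∘ suc) (a ℕ.+ s) ℕ.+ bit (p 0)     ≡⟨ cong (ℕ._+ bit (p 0)) (below-+ (p ∘ suc) a s) ⟩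
    x ℕ.+ y ℕ.+ bit (p 0)                       ≡⟨ ℕₚ.+-assoc x y (bit (p 0)) ⟩
    x ℕ.+ (y ℕ.+ bit (p 0))                     ≡⟨ cong (x ℕ.+_) (ℕₚ.+-comm y (bit (p 0))) ⟩
    x ℕ.+ (bit (p 0) ℕ.+ y)                     ≡⟨ ℕₚ.+-assoc x (bit (p 0)) y ⟨
    x ℕ.+ bit (p 0) ℕ.+ y                       ∎
    where
    open ≡-Reasoning
    x = below (p ∘ suc) a
    y = below (λ r → p (suc a ℕ.+ r)) s

  below-all : ∀ p c → (∀ {r} → r ℕ.< c → p r ≡ true) → below p c ≡ c
  below-all p zero    h = refl
  below-all p (suc c) h = trans (cong₂ ℕ._+_ (below-all (p ∘ suc) c (h ∘ s<s)) (cong bit (h z<s))) (ℕₚ.+-comm c 1)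

  below-none : ∀ p c → (∀ {r} → r ℕ.< c → p r ≡ false) → below p c ≡ 0
  below-none p zero    h = refl
  below-none p (suc c) h = cong₂ ℕ._+_ (below-none (p ∘ suc) c (h ∘ s<s)) (cong bit (h z<s))

  below-cong : ∀ {p q} → p ≗ q → ∀ c → below p c ≡ below q c
  below-cong p≗q zero    = refl
  below-cong p≗q (suc c) = cong₂ ℕ._+_ (below-cong (p≗q ∘ suc) c) (cong bit (p≗q 0))

  below-difference : ∀ p q → (∀ r → p r ≡ true → q r ≡ true) → ∀ c →
    below (λ r → not (p r) ∧ q r) c ℕ.+ below p c ≡ below q c
  below-difference p q p⇒q zero    = refl
  below-difference p q p⇒q (suc c) = begin
    x ℕ.+ bit (not (p 0) ∧ q 0) ℕ.+ (y ℕ.+ bit (p 0))   ≡⟨ interchange ℕₚ.+-commutativeSemigroup x _ y (bit (p 0)) ⟩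
    (x ℕ.+ y) ℕ.+ (bit (not (p 0) ∧ q 0) ℕ.+ bit (p 0)) ≡⟨ cong₂ ℕ._+_ (below-difference (p ∘ suc) (q ∘ suc) (p⇒q ∘ suc) c) first ⟩
    below (q ∘ suc) c ℕ.+ bit (q 0)                     ∎
    where
    open ≡-Reasoning
    x = below (λ r → not (p (suc r)) ∧ q (suc r)) c
    y = below (p ∘ suc) c
    first : bit (not (p 0) ∧ q 0) ℕ.+ bit (p 0) ≡ bit (q 0)
    first with p 0 in p₀
    ... | true  = cong bit (sym (p⇒q 0 p₀))
    ... | false = ℕₚ.+-identityʳ (bit (q 0))

  module _ (m : ℕ) .{{_ : NonZero m}} where

    below-level : ∀ l {c} → suc l ℕ.* m ℕ.≤ c → below (λ r → ⌊ l ≟ r / m ⌋) c ≡ m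
    below-level l {c} h with ℕₚ.m≤n⇒∃[o]m+o≡n h
    ... | e , refl = begin
      below p (m ℕ.+ l ℕ.* m ℕ.+ e)
        ≡⟨ cong (below p) (trans (cong (ℕ._+ e) (ℕₚ.+-comm m (l ℕ.* m))) (ℕₚ.+-assoc (l ℕ.* m) m e)) ⟩
      below p (l ℕ.* m ℕ.+ (m ℕ.+ e))
        ≡⟨ below-+ p (l ℕ.* m) (m ℕ.+ e) ⟩
      below p (l ℕ.* m) ℕ.+ below p′ (m ℕ.+ e)
        ≡⟨ cong₂ ℕ._+_ (below-none p (l ℕ.* m) lower) (below-+ p′ m e) ⟩
      below p′ m ℕ.+ below (λ r → p′ (m ℕ.+ r)) e
        ≡⟨ cong₂ ℕ._+_ (below-all p′ m within) (below-none _ e (λ {r} _ → upper r)) ⟩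
      m ℕ.+ 0
        ≡⟨ ℕₚ.+-identityʳ m ⟩
      m ∎
      where
      open ≡-Reasoning
      p p′ : ℕ → Bool
      p r = ⌊ l ≟ r / m ⌋
      p′ r = p (l ℕ.* m ℕ.+ r)
      lower : ∀ {r} → r ℕ.< l ℕ.* m → p r ≡ false
      lower {r} r<lm = ⌊⌋-false (l ≟ r / m) (ℕₚ.>⇒≢ (m<n*o⇒m/o<n r<lm))
      within : ∀ {r} → r ℕ.< m → p′ r ≡ true
      within {r} r<m = ⌊⌋-true (l ≟ (l ℕ.* m ℕ.+ r) / m) (sym (trans (+-distrib-/-∣ˡ r (divides-refl l))
        (trans (cong₂ ℕ._+_ (m*n/n≡m l m) (m<n⇒m/n≡0 r<m)) (ℕₚ.+-identityʳ l))))
      upper : ∀ r → p′ (m ℕ.+ r) ≡ false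
      upper r = ⌊⌋-false (l ≟ (l ℕ.* m ℕ.+ (m ℕ.+ r)) / m)
        (ℕₚ.<⇒≢ (subst (ℕ._≤ (l ℕ.* m ℕ.+ (m ℕ.+ r)) / m) (m*n/n≡m (suc l) m)
          (/-monoˡ-≤ m (ℕₚ.≤-trans (ℕₚ.≤-reflexive (ℕₚ.+-comm m (l ℕ.* m)))
            (ℕₚ.+-monoʳ-≤ (l ℕ.* m) (ℕₚ.m≤m+n m r))))))

    -- Placements by recursion over the cells

    fits : List Cell → Cell → Bool
    fits occ x = allB (λ o → compatible m o x) occ

    -- placements k occ xs counts the k-element sets of cells of xs that extend the placement occ.
    placements : ℕ → List Cell → List Cell → ℕ
    placements zero    occ []       = 1
    placements (suc k) occ []       = 0
    placements zero    occ (x ∷ xs) = placements zero occ xs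
    placements (suc k) occ (x ∷ xs) =
      placements (suc k) occ xs ℕ.+ (if fits occ x then placements k (x ∷ occ) xs else 0)

    private
      extends : ℕ → List Cell → List Cell → Bool
      extends k occ s = (⌊ length s ≟ k ⌋ ∧ isPlacement m s) ∧ allB (fits occ) s

      extends-∷ : ∀ k occ x s → extends (suc k) occ (x ∷ s) ≡ fits occ x ∧ extends k (x ∷ occ) s
      extends-∷ k occ x s = trans (shuffle ⌊ suc (length s) ≟ suc k ⌋ ⌊ length s ≟ k ⌋
          (trans (isYes≗does (suc (length s) ≟ suc k)) (sym (isYes≗does (length s ≟ k))))
          (allB (compatible m x) s) (isPlacement m s) (fits occ x) (allB (fits occ) s))
        (cong (λ b → fits occ x ∧ ((⌊ length s ≟ k ⌋ ∧ isPlacement m s) ∧ b))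
          (sym (allB-∧ (compatible m x) (fits occ) s)))
        where
        shuffle : ∀ l l′ → l ≡ l′ → ∀ c p f a → (l ∧ (c ∧ p)) ∧ (f ∧ a) ≡ f ∧ ((l′ ∧ p) ∧ (c ∧ a))
        shuffle false _ refl c     p     f     a = sym (∧-zeroʳ f)
        shuffle true  _ refl false p     f     a = sym (trans (cong (f ∧_) (∧-zeroʳ p)) (∧-zeroʳ f))
        shuffle true  _ refl true  false f     a = sym (∧-zeroʳ f)
        shuffle true  _ refl true  true  f     a = refl

    -- `extends` is the test in `rook` together with compatibility with `occ`. Thanks to this
    -- parameter the sublists through `x` are counted by the same function, with `x` joining `occ`.
    countᵇ-subsets : ∀ k occ xs → countᵇ (extends k occ) (subsets xs) ≡ placements k occ xs
    countᵇ-subsets zero    occ [] = refl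
    countᵇ-subsets (suc k) occ [] = refl
    countᵇ-subsets zero    occ (x ∷ xs) = begin
      countᵇ (extends 0 occ) (subsets xs ++ map (x ∷_) (subsets xs))
        ≡⟨ countᵇ-++ (extends 0 occ) (subsets xs) _ ⟩
      countᵇ (extends 0 occ) (subsets xs) ℕ.+ countᵇ (extends 0 occ) (map (x ∷_) (subsets xs))
        ≡⟨ cong₂ ℕ._+_ (countᵇ-subsets 0 occ xs) (trans (countᵇ-map (extends 0 occ) (x ∷_) (subsets xs)) (countᵇ-false (subsets xs))) ⟩
      placements 0 occ xs ℕ.+ 0
        ≡⟨ ℕₚ.+-identityʳ _ ⟩
      placements 0 occ xs ∎
      where open ≡-Reasoning
    countᵇ-subsets (suc k) occ (x ∷ xs) = begin
      countᵇ (extends (suc k) occ) (subsets xs ++ map (x ∷_) (subsets xs))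
        ≡⟨ countᵇ-++ (extends (suc k) occ) (subsets xs) _ ⟩
      countᵇ (extends (suc k) occ) (subsets xs) ℕ.+ countᵇ (extends (suc k) occ) (map (x ∷_) (subsets xs))
        ≡⟨ cong₂ ℕ._+_ (countᵇ-subsets (suc k) occ xs)
             (trans (countᵇ-map (extends (suc k) occ) (x ∷_) (subsets xs))
               (trans (countᵇ-cong (extends-∷ k occ x) (subsets xs)) with-x)) ⟩
      placements (suc k) occ (x ∷ xs) ∎
      where
      open ≡-Reasoning
      with-x : countᵇ (λ s → fits occ x ∧ extends k (x ∷ occ) s) (subsets xs)
             ≡ (if fits occ x then placements k (x ∷ occ) xs else 0)
      with-x with fits occ x
      ... | true  = countᵇ-subsets k (x ∷ occ) xs
      ... | false = countᵇ-false (subsets xs)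

    rook≡placements : ∀ k b → rook m k b ≡ placements k [] (cells b)
    rook≡placements k b = trans (countᵇ-cong unrestricted (subsets (cells b))) (countᵇ-subsets k [] (cells b))
      where
      unrestricted : ∀ s → ⌊ length s ≟ k ⌋ ∧ isPlacement m s ≡ extends k [] s
      unrestricted s = sym (trans (cong ((⌊ length s ≟ k ⌋ ∧ isPlacement m s) ∧_)
        (allB-true {p = fits []} (All.universal (λ _ → refl) s))) (∧-comm _ true))

    placements-0 : ∀ occ xs → placements 0 occ xs ≡ 1
    placements-0 occ []       = refl
    placements-0 occ (x ∷ xs) = placements-0 occ xs

    -- Adding a last column

    fitting : List Cell → List Cell → ℕ
    fitting occ []       = 0
    fitting occ (y ∷ ys) = fitting occ ys ℕ.+ bit (fits occ y)

    placements-blocked : ∀ k {y occ ys} → All (λ z → compatible m y z ≡ false) ys →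
      placements (suc k) (y ∷ occ) ys ≡ 0
    placements-blocked k []         = refl
    placements-blocked k {y} {occ} (_∷_ {z} {ys} p ps) = cong₂ ℕ._+_ (placements-blocked k ps)
      (cong (λ b → if b ∧ fits occ z then placements k (z ∷ y ∷ occ) ys else 0) p)

    Column : List Cell → Set
    Column = AllPairs (λ y z → compatible m y z ≡ false)

    placements-column-1 : ∀ occ {ys} → Column ys → placements 1 occ ys ≡ fitting occ ys
    placements-column-1 occ []              = refl
    placements-column-1 occ (_∷_ {y} {ys} p ps) = cong₂ ℕ._+_ (placements-column-1 occ ps)
      (cong (λ c → if fits occ y then c else 0) (placements-0 (y ∷ occ) ys))

    placements-column-2 : ∀ k occ {ys} → Column ys → placements (suc (suc k)) occ ys ≡ 0
    placements-column-2 k occ []                  = refl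
    placements-column-2 k occ (_∷_ {y} {ys} p ps) = cong₂ ℕ._+_ (placements-column-2 k occ ps)
      (trans (cong (λ c → if fits occ y then c else 0) (placements-blocked k p)) (if-0 (fits occ y)))
      where
      if-0 : ∀ b → (if b then 0 else 0) ≡ 0
      if-0 true  = refl
      if-0 false = refl

    lev : Cell → ℕ
    lev (_ , r) = level m r

    column : ℕ → ℕ → List Cell
    column j c = map (λ r → j , suc r) (upTo c)

    column-Column : ∀ j c → Column (column j c)
    column-Column j c = subst Column (sym (map-upTo (λ r → j , suc r) c))
      (AllPairsₚ.applyUpTo⁺₂ _ c (λ r r′ → cong (λ b → not b ∧ not ⌊ r / m ≟ r′ / m ⌋) (⌊⌋-true (j ≟ j) refl)))

    -- The whole level of the cell lies in column j of height c, so that a rook there blocks m cells.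
    Left : (j c : ℕ) → Cell → Set
    Left j c x = proj₁ x ℕ.< j × suc (lev x) ℕ.* m ℕ.≤ c

    -- Only levels are recorded: distinct levels make the sets of cells blocked in a later column
    -- disjoint.
    Placement : List Cell → Set
    Placement = AllPairs (λ x y → lev x ≢ lev y)

    module _ {j c : ℕ} where

      compatible-column : ∀ {o} → Left j c o → ∀ r → compatible m o (j , suc r) ≡ not ⌊ lev o ≟ r / m ⌋
      compatible-column {o} (o<j , _) r =
        cong (λ b → not b ∧ not ⌊ lev o ≟ r / m ⌋) (⌊⌋-false (proj₁ o ≟ j) (ℕₚ.<⇒≢ o<j))

      -- Each rook of `occ` removes the `m` cells of its level from the column. The equation is
      -- additive, so no truncated subtraction appears.
      below-fits : ∀ {occ} → All (Left j c) occ → Placement occ →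
        below (λ r → fits occ (j , suc r)) c ℕ.+ length occ ℕ.* m ≡ c
      below-fits [] [] = trans (ℕₚ.+-identityʳ _) (below-all _ c (λ _ → refl))
      below-fits {o ∷ occ} (l ∷ ls) (p ∷ ps) = begin
        below (λ r → compatible m o (j , suc r) ∧ q r) c ℕ.+ (m ℕ.+ length occ ℕ.* m)
          ≡⟨ cong₂ ℕ._+_ (below-cong (λ r → cong (_∧ q r) (compatible-column {o} l r)) c)
               (cong (ℕ._+ length occ ℕ.* m) (sym (below-level (lev o) (proj₂ l)))) ⟩
        below (λ r → not (p′ r) ∧ q r) c ℕ.+ (below p′ c ℕ.+ length occ ℕ.* m)
          ≡⟨ ℕₚ.+-assoc (below (λ r → not (p′ r) ∧ q r) c) (below p′ c) (length occ ℕ.* m) ⟨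
        below (λ r → not (p′ r) ∧ q r) c ℕ.+ below p′ c ℕ.+ length occ ℕ.* m
          ≡⟨ cong (ℕ._+ length occ ℕ.* m) (below-difference p′ q p′⇒q c) ⟩
        below q c ℕ.+ length occ ℕ.* m
          ≡⟨ below-fits ls ps ⟩
        c ∎
        where
        open ≡-Reasoning
        p′ q : ℕ → Bool
        p′ r = ⌊ lev o ≟ r / m ⌋
        q r  = fits occ (j , suc r)
        -- A cell in the level of `o` is blocked by none of the other rooks, so `o` really costs `m`
        -- further cells.
        p′⇒q : ∀ r → p′ r ≡ true → q r ≡ true
        p′⇒q r eq with lev o ≟ r / m
        ... | yes lo≡ = allB-true (All.zipWith
          (λ {o′} (l′ , lo≢) → trans (compatible-column {o′} l′ r)
            (cong not (⌊⌋-false (lev o′ ≟ r / m) (λ lo′≡ → lo≢ (trans lo≡ (sym lo′≡))))))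
          (ls , p))

      fitting-column : ∀ {occ} → All (Left j c) occ → Placement occ →
        + fitting occ (column j c) ≡ + c - + length occ * + m
      fitting-column {occ} ls ps = begin
        + fitting occ (column j c)              ≡⟨ cong +_ (trans (cong (fitting occ) (map-upTo _ c)) (fitting-below _ c)) ⟩
        + f                                     ≡⟨ identity (+ f) (+ (length occ ℕ.* m)) ⟩
        (+ f + + (length occ ℕ.* m)) - + (length occ ℕ.* m) ≡⟨ cong₂ (λ s t → s - t) (cong +_ (below-fits ls ps)) (ℤₚ.pos-* (length occ) m) ⟩
        + c - + length occ * + m                ∎
        where
        open ≡-Reasoning
        f = below (λ r → fits occ (j , suc r)) c
        fitting-below : ∀ (g : ℕ → Cell) c → fitting occ (applyUpTo g c) ≡ below (fits occ ∘ g) c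
        fitting-below g zero    = refl
        fitting-below g (suc c) = cong (ℕ._+ bit (fits occ (g 0))) (fitting-below (g ∘ suc) c)
        identity : ∀ x y → x ≡ (x + y) - y
        identity = solve-∀

      fits⇒Placement : ∀ {occ x} → fits occ x ≡ true → All (λ o → lev x ≢ lev o) occ
      fits⇒Placement {[]}      _ = []
      fits⇒Placement {o ∷ occ} {x} eq with ⌊ proj₁ o ≟ proj₁ x ⌋ | lev o ≟ lev x | eq
      ... | false | no lo≢ | eq′ = lo≢ ∘ sym ∷ fits⇒Placement {occ} {x} eq′

      -- The general `occ` carries the induction on `xs`: choosing `x` moves one rook from the `k`
      -- to come into `occ`, so `length occ + k`, and with it the number of free cells in the
      -- column, stays the same.
      placements-snoc : ∀ k {occ xs} → All (Left j c) occ → Placement occ → All (Left j c) xs →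
        + placements (suc k) occ (xs ++ column j c)
        ≡ + placements (suc k) occ xs + (+ c - + (length occ ℕ.+ k) * + m) * + placements k occ xs
      placements-snoc zero {occ} {[]} ls ps [] = begin
        + placements 1 occ (column j c)
          ≡⟨ cong +_ (placements-column-1 occ (column-Column j c)) ⟩
        + fitting occ (column j c)
          ≡⟨ fitting-column ls ps ⟩
        + c - + length occ * + m
          ≡⟨ cong (λ l → + c - + l * + m) (ℕₚ.+-identityʳ (length occ)) ⟨
        + c - + (length occ ℕ.+ 0) * + m
          ≡⟨ identity _ ⟩
        0ℤ + (+ c - + (length occ ℕ.+ 0) * + m) * 1ℤ ∎
        where
        open ≡-Reasoning
        identity : ∀ x → x ≡ 0ℤ + x * 1ℤ
        identity = solve-∀
      placements-snoc (suc k) {occ} {[]} ls ps [] =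
        trans (cong +_ (placements-column-2 k occ (column-Column j c)))
          (identity (+ c - + (length occ ℕ.+ suc k) * + m))
        where
        identity : ∀ x → 0ℤ ≡ 0ℤ + x * 0ℤ
        identity = solve-∀
      placements-snoc k {occ} {x ∷ xs} ls ps (lx ∷ lxs) with fits occ x in fx
      placements-snoc zero {occ} {x ∷ xs} ls ps (lx ∷ lxs) | false = begin
        + (placements 1 occ (xs ++ column j c) ℕ.+ 0)
          ≡⟨ cong +_ (ℕₚ.+-identityʳ _) ⟩
        + placements 1 occ (xs ++ column j c)
          ≡⟨ placements-snoc zero ls ps lxs ⟩
        + placements 1 occ xs + g * + placements 0 occ xs
          ≡⟨ cong (λ r → + r + g * + placements 0 occ xs) (ℕₚ.+-identityʳ (placements 1 occ xs)) ⟨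
        + (placements 1 occ xs ℕ.+ 0) + g * + placements 0 occ xs ∎
        where
        open ≡-Reasoning
        g = + c - + (length occ ℕ.+ 0) * + m
      placements-snoc (suc k) {occ} {x ∷ xs} ls ps (lx ∷ lxs) | false rewrite fx = begin
        + (placements (2 ℕ.+ k) occ (xs ++ column j c) ℕ.+ 0)
          ≡⟨ cong +_ (ℕₚ.+-identityʳ _) ⟩
        + placements (2 ℕ.+ k) occ (xs ++ column j c)
          ≡⟨ placements-snoc (suc k) ls ps lxs ⟩
        + placements (2 ℕ.+ k) occ xs + g * + placements (suc k) occ xs
          ≡⟨ cong₂ (λ r s → + r + g * + s) (ℕₚ.+-identityʳ (placements (2 ℕ.+ k) occ xs)) (ℕₚ.+-identityʳ (placements (suc k) occ xs)) ⟨
        + (placements (2 ℕ.+ k) occ xs ℕ.+ 0) + g * + (placements (suc k) occ xs ℕ.+ 0) ∎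
        where
        open ≡-Reasoning
        g = + c - + (length occ ℕ.+ suc k) * + m
      placements-snoc zero {occ} {x ∷ xs} ls ps (lx ∷ lxs) | true = begin
        + (placements 1 occ (xs ++ column j c) ℕ.+ placements 0 (x ∷ occ) (xs ++ column j c))
          ≡⟨ cong₂ (λ u v → u + + v) (placements-snoc zero ls ps lxs) (trans (placements-0 (x ∷ occ) (xs ++ column j c)) (sym (placements-0 (x ∷ occ) xs))) ⟩
        (+ placements 1 occ xs + g * + placements 0 occ xs) + + placements 0 (x ∷ occ) xs
          ≡⟨ identity (+ placements 1 occ xs) (g * + placements 0 occ xs) (+ placements 0 (x ∷ occ) xs) ⟩
        (+ placements 1 occ xs + + placements 0 (x ∷ occ) xs) + g * + placements 0 occ xs ∎
        where
        open ≡-Reasoning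
        g = + c - + (length occ ℕ.+ 0) * + m
        identity : ∀ a b c → (a + b) + c ≡ (a + c) + b
        identity = solve-∀
      placements-snoc (suc k) {occ} {x ∷ xs} ls ps (lx ∷ lxs) | true rewrite fx = begin
        + placements (2 ℕ.+ k) occ (xs ++ column j c) + + placements (suc k) (x ∷ occ) (xs ++ column j c)
          ≡⟨ cong₂ _+_ (placements-snoc (suc k) ls ps lxs)
               (placements-snoc k {x ∷ occ} (lx ∷ ls) (fits⇒Placement {occ} {x} fx ∷ ps) lxs) ⟩
        (+ placements (2 ℕ.+ k) occ xs + g * + placements (suc k) occ xs)
          + (+ placements (suc k) (x ∷ occ) xs + (+ c - + (suc (length occ) ℕ.+ k) * + m) * + placements k (x ∷ occ) xs)
          ≡⟨ cong (λ l → (+ placements (2 ℕ.+ k) occ xs + g * + placements (suc k) occ xs)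
                       + (+ placements (suc k) (x ∷ occ) xs + (+ c - + l * + m) * + placements k (x ∷ occ) xs))
               (sym (ℕₚ.+-suc (length occ) k)) ⟩
        (+ placements (2 ℕ.+ k) occ xs + g * + placements (suc k) occ xs)
          + (+ placements (suc k) (x ∷ occ) xs + g * + placements k (x ∷ occ) xs)
          ≡⟨ identity g (+ placements (2 ℕ.+ k) occ xs) (+ placements (suc k) occ xs)
               (+ placements (suc k) (x ∷ occ) xs) (+ placements k (x ∷ occ) xs) ⟩
        (+ placements (2 ℕ.+ k) occ xs + + placements (suc k) (x ∷ occ) xs)
          + g * (+ placements (suc k) occ xs + + placements k (x ∷ occ) xs) ∎
        where
        open ≡-Reasoning
        g = + c - + (length occ ℕ.+ suc k) * + m
        identity : ∀ g a b c d → (a + g * b) + (c + g * d) ≡ (a + c) + g * (b + d)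
        identity = solve-∀

    -- b rounded up to a multiple of m is at most c: this is the condition that
    -- singleton boards impose on adjacent columns (see Linked-⊴).
    _⊴_ : ℕ → ℕ → Set
    b ⊴ c = ∀ {r} → r ℕ.< b → suc (r / m) ℕ.* m ℕ.≤ c

    cells-snoc : ∀ j bs c → cells' j (bs ∷ʳ c) ≡ cells' j bs ++ column (j ℕ.+ length bs) c
    cells-snoc j []       c = trans (++-identityʳ (column j c)) (cong (λ i → column i c) (sym (ℕₚ.+-identityʳ j)))
    cells-snoc j (b ∷ bs) c = begin
      column j b ++ cells' (suc j) (bs ∷ʳ c)
        ≡⟨ cong (column j b ++_) (cells-snoc (suc j) bs c) ⟩
      column j b ++ (cells' (suc j) bs ++ column (suc j ℕ.+ length bs) c)
        ≡⟨ ++-assoc (column j b) (cells' (suc j) bs) _ ⟨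
      (column j b ++ cells' (suc j) bs) ++ column (suc j ℕ.+ length bs) c
        ≡⟨ cong (λ i → (column j b ++ cells' (suc j) bs) ++ column i c) (ℕₚ.+-suc j (length bs)) ⟨
      (column j b ++ cells' (suc j) bs) ++ column (j ℕ.+ suc (length bs)) c ∎
      where open ≡-Reasoning

    cells-Left : ∀ j {c} bs → All (_⊴ c) bs → All (Left (j ℕ.+ length bs) c) (cells' j bs)
    cells-Left j []       []       = []
    cells-Left j {c} (b ∷ bs) (p ∷ ps) = Allₚ.++⁺
      (subst (All _) (sym (map-upTo (λ r → j , suc r) b))
        (Allₚ.applyUpTo⁺₁ _ b (λ r<b → ℕₚ.m<m+n j z<s , p r<b)))
      (subst (λ i → All (Left i c) (cells' (suc j) bs)) (sym (ℕₚ.+-suc j (length bs)))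
        (cells-Left (suc j) bs ps))

    -- Rook numbers of the board with column heights bs, listed from right to left.
    rooks : List ℕ → ℕ → ℤ
    rooks []       zero    = 1ℤ
    rooks []       (suc k) = 0ℤ
    rooks (b ∷ bs) zero    = rooks bs zero
    rooks (b ∷ bs) (suc k) = rooks bs (suc k) + (+ b - + k * + m) * rooks bs k

    placements-cells : ∀ j bs → AllPairs (flip _⊴_) bs → ∀ k →
      + placements k [] (cells' j (reverse bs)) ≡ rooks bs k
    placements-cells j []       _        zero    = refl
    placements-cells j []       _        (suc k) = refl
    placements-cells j (b ∷ bs) (p ∷ ps) zero    = trans
      (cong +_ (placements-0 [] (cells' j (reverse (b ∷ bs)))))
      (trans (cong +_ (sym (placements-0 [] (cells' j (reverse bs))))) (placements-cells j bs ps zero))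
    placements-cells j (b ∷ bs) (p ∷ ps) (suc k) = begin
      + placements (suc k) [] (cells' j (reverse (b ∷ bs)))
        ≡⟨ cong (λ xs → + placements (suc k) [] xs)
             (trans (cong (cells' j) (unfold-reverse b bs)) (cells-snoc j (reverse bs) b)) ⟩
      + placements (suc k) [] (cells' j (reverse bs) ++ column (j ℕ.+ length (reverse bs)) b)
        ≡⟨ placements-snoc k [] [] (cells-Left j (reverse bs) (Permₚ.All-resp-↭ (↭-sym (Permₚ.↭-reverse bs)) p)) ⟩
      + placements (suc k) [] (cells' j (reverse bs)) + (+ b - + k * + m) * + placements k [] (cells' j (reverse bs))
        ≡⟨ cong₂ (λ r s → r + (+ b - + k * + m) * s) (placements-cells j bs ps (suc k)) (placements-cells j bs ps k) ⟩
      rooks (b ∷ bs) (suc k) ∎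
      where open ≡-Reasoning

open Words
open Roots
open Rooks
open import Data.Integer using (ℤ; +_; 0ℤ; 1ℤ)
open import Data.Nat using (_+_; _*_; _∸_; _≤_; _<_)
open import Data.Nat.Properties hiding (_≟_)

-- Words with equal letter counts

count-↭ : ∀ {v w} → v ↭ w → ∀ i → count i v ≡ count i w
count-↭ p i = Permₚ.↭-length (Permₚ.filter-↭ (_≟ i) p)

count⇒∈ : ∀ {i k} w → count i w ≡ suc k → i ∈ w
count⇒∈ {i} (x ∷ w) eq with x ≟ i
... | yes refl = here refl
... | no x≢i   = there (count⇒∈ w (trans (sym (count-there x≢i w)) eq))

count⇒↭ : ∀ v w → (∀ i → count i v ≡ count i w) → v ↭ w
count⇒↭ []      []      eq = Perm.refl
count⇒↭ []      (y ∷ w) eq = contradiction (trans (eq y) (count-here y w)) λ ()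
count⇒↭ (x ∷ v) w       eq with ∈-∃++ (count⇒∈ w (trans (sym (eq x)) (count-here x v)))
... | ys , zs , refl = ↭-trans (Perm.prep x (count⇒↭ v (ys ++ zs) eq′)) (↭-sym (Permₚ.shift x ys zs))
  where
  eq″ : ∀ i → count i (x ∷ v) ≡ count i (x ∷ ys ++ zs)
  eq″ i = trans (eq i) (count-↭ (Permₚ.shift x ys zs) i)
  eq′ : ∀ i → count i v ≡ count i (ys ++ zs)
  eq′ i with x ≟ i
  ... | yes refl = suc-injective (trans (sym (count-here x v)) (trans (eq″ x) (count-here x (ys ++ zs))))
  ... | no x≢i   = trans (sym (count-there x≢i v)) (trans (eq″ i) (count-there x≢i (ys ++ zs)))

cnt-map : ∀ w i → cnt (map +_ w) i ≡ count i w
cnt-map []      i = refl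
cnt-map (x ∷ w) i with x ≟ i
... | yes refl = trans (cong length (filter-accept (ℤ._≟ + i) {xs = map +_ w} refl))
  (trans (cong suc (cnt-map w i)) (sym (count-here x w)))
... | no x≢i = trans (cong length (filter-reject (ℤ._≟ + i) {xs = map +_ w} (x≢i ∘ ℤₚ.+-injective)))
  (trans (cnt-map w i) (sym (count-there x≢i w)))

AllPairs-reverse : ∀ {A : Set} {R : A → A → Set} {xs} → AllPairs R xs → AllPairs (flip R) (reverse xs)
AllPairs-reverse [] = []
AllPairs-reverse {R = R} (_∷_ {x} {xs} p ps) = subst (AllPairs (flip R)) (sym (unfold-reverse x xs))
  (AllPairsₚ.++⁺ (AllPairs-reverse ps) ([] ∷ [])
    (All.map (_∷ []) (Permₚ.All-resp-↭ (↭-sym (Permₚ.↭-reverse xs)) p)))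

-- Boards and their zero columns

strip : List ℕ → List ℕ
strip []           = []
strip (zero ∷ bs)  = strip bs
strip (suc b ∷ bs) = suc b ∷ bs

strip-replicate : ∀ p bs → strip (replicate p 0 ++ bs) ≡ strip bs
strip-replicate zero    bs = refl
strip-replicate (suc p) bs = strip-replicate p bs

strip-board : ∀ {bs} → IsBoard bs → strip bs ≡ bs
strip-board {[]}         _ = refl
strip-board {suc b ∷ bs} _ = refl

strip-padTo : ∀ N {bs} → IsBoard bs → strip (padTo N bs) ≡ bs
strip-padTo N {bs} hb = trans (strip-replicate (N ∸ length bs) bs) (strip-board hb)

length-strip : ∀ bs → length (strip bs) ≤ length bs
length-strip []           = z≤n
length-strip (zero ∷ bs)  = m≤n⇒m≤1+n (length-strip bs)
length-strip (suc b ∷ bs) = ≤-refl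

padTo-strip : ∀ bs → padTo (length bs) (strip bs) ≡ bs
padTo-strip []          = refl
padTo-strip (zero ∷ bs) = trans
  (cong (λ p → replicate p 0 ++ strip bs) (+-∸-assoc 1 (length-strip bs)))
  (cong (0 ∷_) (padTo-strip bs))
padTo-strip (suc b ∷ bs) = cong (λ p → replicate p 0 ++ suc b ∷ bs) (n∸n≡0 (length bs))

strip-Linked : ∀ {R : ℕ → ℕ → Set} bs → Linked R bs → Linked R (strip bs)
strip-Linked []           l = l
strip-Linked (zero ∷ bs)  l = strip-Linked bs (Linked.tail l)
strip-Linked (suc b ∷ bs) l = l

strip-IsBoard : ∀ bs → Linked _≤_ bs → IsBoard (strip bs)
strip-IsBoard []           l = tt
strip-IsBoard (zero ∷ bs)  l = strip-IsBoard bs (Linked.tail l)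
strip-IsBoard (suc b ∷ bs) l = z<s , l

board-≤ : ∀ bs → IsBoard bs → Linked _≤_ bs
board-≤ []       _       = []
board-≤ (b ∷ bs) (_ , l) = l

board-positive : ∀ bs → IsBoard bs → All (0 <_) bs
board-positive []       _       = []
board-positive (b ∷ bs) (p , l) = Linked⇒All ≤-trans p l

length≤sum : ∀ {bs} → All (0 <_) bs → length bs ≤ sum bs
length≤sum []       = z≤n
length≤sum (p ∷ ps) = +-mono-≤ p (length≤sum ps)

length-padTo : ∀ N bs → length bs ≤ N → length (padTo N bs) ≡ N
length-padTo N bs h = begin
  length (replicate (N ∸ length bs) 0 ++ bs)         ≡⟨ length-++ (replicate (N ∸ length bs) 0) ⟩
  length (replicate (N ∸ length bs) 0) + length bs   ≡⟨ cong (λ l → l + length bs) (length-replicate (N ∸ length bs)) ⟩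
  N ∸ length bs + length bs                          ≡⟨ m∸n+n≡m h ⟩
  N                                                  ∎
  where open ≡-Reasoning

-- Singleton boards through rounding up to multiples of `m`

module _ (m : ℕ) .{{_ : NonZero m}} where

  private
    infix 4 _≼_
    _≼_ : ℕ → ℕ → Set
    _≼_ = _⊴_ m

  ⊴⇒≤ : ∀ {b c} → b ≼ c → b ≤ c
  ⊴⇒≤ {zero}  h = z≤n
  ⊴⇒≤ {suc b} h = ≤-trans (<-next m b) (h ≤-refl)

  ⊴-trans : ∀ {b c d} → b ≼ c → c ≼ d → b ≼ d
  ⊴-trans b⊴c c⊴d r<b = ≤-trans (b⊴c r<b) (⊴⇒≤ c⊴d)

  0⊴ : ∀ {c} → 0 ≼ c
  0⊴ ()

  flr≤ : ∀ b → flr m b ≤ b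
  flr≤ b = m/n*n≤m b m

  ⊴⇒flr< : ∀ {b c} → b ≼ c → flr m b ≢ b → flr m b < flr m c
  ⊴⇒flr< {b} {c} h flr≢ = *-monoˡ-< m (begin
    suc (b / m)                   ≡⟨ cong suc (m*n/n≡m (b / m) m) ⟨
    suc (flr m b / m)             ≡⟨ m*n/n≡m (suc (flr m b / m)) m ⟨
    -- Since `b` is no multiple of `m`, the row index `flr m b` lies below `b`; its level ends at
    -- the next multiple, which is at most `c`.
    suc (flr m b / m) * m / m     ≤⟨ /-monoˡ-≤ m (h (≤∧≢⇒< (flr≤ b) flr≢)) ⟩
    c / m                         ∎)
    where open ≤-Reasoning

  -- If `b` is a multiple of `m`, the levels of its cells end by `b`; otherwise they end by the
  -- multiple after `flr m b`, which is at most `flr m c`.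
  flr<⇒⊴ : ∀ {b c} → b ≤ c → (flr m b ≢ b → flr m b < flr m c) → b ≼ c
  flr<⇒⊴ {b} {c} b≤c h {r} r<b with flr m b ≟ b
  ... | yes flr≡ = ≤-trans (*-monoˡ-≤ m (m<n*o⇒m/o<n {n = b / m} (<-≤-trans r<b (≤-reflexive (sym flr≡)))))
    (≤-trans (flr≤ b) b≤c)
  ... | no flr≢ = ≤-trans (*-monoˡ-≤ m (≤-<-trans (/-monoˡ-≤ m (<⇒≤ r<b)) (*-cancelʳ-< m (b / m) (c / m) (h flr≢))))
    (flr≤ c)

  Linked-⊴ : ∀ bs → Linked _≤_ bs → Singleton m bs → Linked _≼_ bs
  Linked-⊴ []           _         _       = []
  Linked-⊴ (b ∷ [])     _         _       = [-]
  Linked-⊴ (b ∷ c ∷ bs) (b≤c ∷ l) (h , s) = flr<⇒⊴ b≤c h ∷ Linked-⊴ (c ∷ bs) l s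

  Linked-⊴⇒Singleton : ∀ {bs} → Linked _≼_ bs → Singleton m bs
  Linked-⊴⇒Singleton []        = tt
  Linked-⊴⇒Singleton [-]       = tt
  Linked-⊴⇒Singleton (b⊴c ∷ l) = ⊴⇒flr< b⊴c , Linked-⊴⇒Singleton l

  Linked-replicate : ∀ p {bs} → Linked _≼_ bs → Linked _≼_ (replicate p 0 ++ bs)
  Linked-replicate zero          l             = l
  Linked-replicate (suc zero)    {[]}     l    = [-]
  Linked-replicate (suc zero)    {b ∷ bs} l    = 0⊴ ∷ l
  Linked-replicate (suc (suc p))          l    = 0⊴ ∷ Linked-replicate (suc p) l

  -- The root vector of a singleton board: a zone has its only nonzero remainder
  -- in its last column, so that a_j is (j - 1) m - b_j throughout.

  roots : ℕ → List ℕ → List ℤ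
  roots j []       = []
  roots j (b ∷ bs) = (+ (j * m) ℤ.- + b) ∷ roots (suc j) bs

  floor-rem : ∀ j b → + (j * m) ℤ.- + flr m b ℤ.- + rho m b ≡ + (j * m) ℤ.- + b
  floor-rem j b = trans (identity (+ (j * m)) (+ flr m b) (+ rho m b))
    (cong (λ x → + (j * m) ℤ.- + x) (m+[n∸m]≡n (flr≤ b)))
    where
    identity : ∀ x f r → x ℤ.- f ℤ.- r ≡ x ℤ.- (f ℤ.+ r)
    identity = solve-∀

  zeta'≡roots : ∀ j bs → Singleton m bs → zeta' m j 0 bs ≡ roots j bs
  zeta'≡roots j []           _       = refl
  zeta'≡roots j (b ∷ [])     _       = cong (_∷ []) (floor-rem j b)
  zeta'≡roots j (b ∷ c ∷ bs) (h , s) with flr m b ≟ flr m c | zeta'≡roots (suc j) (c ∷ bs) s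
  ... | no  _    | ih = cong₂ _∷_ (floor-rem j b) ih
  ... | yes flr≡ | ih with flr m b ≟ b
  ...   | no flr≢  = contradiction flr≡ (<⇒≢ (h flr≢))
  -- A column followed by one of its own zone has remainder 0, so the accumulator stays 0.
  ...   | yes flrb = cong₂ _∷_ (cong (λ x → + (j * m) ℤ.- + x) flrb)
    (trans (cong (λ acc → zeta' m (suc j) acc (c ∷ bs)) (m≤n⇒m∸n≡0 (≤-reflexive (sym flrb)))) ih)

  -- Heights and letters as complements of each other

  -- Says that `roots j` has no negative entry, so that the truncated subtraction in `complement` is
  -- exact.
  Bounded : ℕ → List ℕ → Set
  Bounded j []       = ⊤
  Bounded j (b ∷ bs) = b ≤ j * m × Bounded (suc j) bs

  complement : ℕ → List ℕ → List ℕ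
  complement j []       = []
  complement j (b ∷ bs) = (j * m ∸ b) ∷ complement (suc j) bs

  complement-involutive : ∀ j bs → Bounded j bs → complement j (complement j bs) ≡ bs
  complement-involutive j []       _       = refl
  complement-involutive j (b ∷ bs) (p , h) = cong₂ _∷_ (m∸[m∸n]≡n p) (complement-involutive (suc j) bs h)

  complement-Bounded : ∀ j bs → Bounded j (complement j bs)
  complement-Bounded j []       = tt
  complement-Bounded j (b ∷ bs) = m∸n≤m (j * m) b , complement-Bounded (suc j) bs

  length-complement : ∀ j bs → length (complement j bs) ≡ length bs
  length-complement j []       = refl
  length-complement j (b ∷ bs) = cong suc (length-complement (suc j) bs)

  roots≡complement : ∀ j bs → Bounded j bs → roots j bs ≡ map +_ (complement j bs)
  roots≡complement j []       _       = refl
  roots≡complement j (b ∷ bs) (p , h) = cong₂ _∷_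
    (trans (ℤₚ.m-n≡m⊖n (j * m) b) (ℤₚ.⊖-≥ p)) (roots≡complement (suc j) bs h)

  -- Limits the letters that occur, so that the first `N` blocks give the whole product.
  complement-< : ∀ j bs → All (_< (j + length bs) * m) (complement j bs)
  complement-< j []       = []
  complement-< j (b ∷ bs) =
    ≤-<-trans (m∸n≤m (j * m) b) (*-monoˡ-< m (m<m+n j z<s))
    ∷ subst (λ i → All (_< i * m) (complement (suc j) bs)) (sym (+-suc j (length bs))) (complement-< (suc j) bs)

  ceil≤⇒⊴ : ∀ t {b c} → b ≤ t * m → t * m ≤ c → b ≼ c
  ceil≤⇒⊴ t b≤tm tm≤c r<b = ≤-trans (*-monoˡ-≤ m (m<n*o⇒m/o<n {n = t} (<-≤-trans r<b b≤tm))) tm≤c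

  ⊴⇒ceil≤ : ∀ t {b c} → t * m < b + m → b ≼ c → t * m ≤ c
  ⊴⇒ceil≤ zero    _      _ = z≤n
  -- The row index `t * m` lies below `b`, and its level ends at `suc t * m`.
  ⊴⇒ceil≤ (suc t) {b} {c} tm<b+m h = subst (λ q → suc q * m ≤ c) (m*n/n≡m t m)
    (h (+-cancelʳ-< m (t * m) b (<-≤-trans (≤-reflexive (cong suc (+-comm (t * m) m))) tm<b+m)))

  module _ {j b : ℕ} (b≤ : b ≤ j * m) where

    private
      a = j * m ∸ b
      q = a / m
      -- `t * m` is `b` rounded up to a multiple of `m`: rounding `a` down rounds `b = j * m - a`
      -- up.
      t = j ∸ q
      q≤j : q ≤ j
      q≤j = ≤-trans (/-monoˡ-≤ m (m∸n≤m (j * m) b)) (≤-reflexive (m*n/n≡m j m))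
      tm≡ : t * m ≡ b + a % m
      tm≡ = +-cancelʳ-≡ (q * m) (t * m) (b + a % m) (begin
        t * m + q * m          ≡⟨ *-distribʳ-+ m t q ⟨
        (t + q) * m            ≡⟨ cong (_* m) (m∸n+n≡m q≤j) ⟩
        j * m                  ≡⟨ m+[n∸m]≡n b≤ ⟨
        b + a                  ≡⟨ cong (_+_ b) (m≡m%n+[m/n]*n a m) ⟩
        b + (a % m + q * m)    ≡⟨ +-assoc b (a % m) (q * m) ⟨
        b + a % m + q * m      ∎)
        where open ≡-Reasoning
      split : suc j * m ≡ t * m + suc q * m
      split = trans (cong (_* m) (sym (trans (+-suc t q) (cong suc (m∸n+n≡m q≤j))))) (*-distribʳ-+ m t (suc q))

    -- Since `next m a` is `suc q * m`, the chain condition on the letters says `t * m ≤ c`, which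
    -- is the rounding condition on the heights.
    ⊴⇒≤next : ∀ {c} → b ≼ c → suc j * m ∸ c ≤ next m a
    ⊴⇒≤next {c} h = m≤n+o⇒m∸n≤o (suc j * m) c (begin
      suc j * m            ≡⟨ split ⟩
      t * m + suc q * m    ≤⟨ +-monoˡ-≤ (suc q * m) (⊴⇒ceil≤ t
                                (≤-<-trans (≤-reflexive tm≡) (+-monoʳ-< b (m%n<n a m))) h) ⟩
      c + suc q * m        ∎)
      where open ≤-Reasoning

    ≤next⇒⊴ : ∀ {c} → suc j * m ∸ c ≤ next m a → b ≼ c
    ≤next⇒⊴ {c} h = ceil≤⇒⊴ t (≤-trans (m≤m+n b (a % m)) (≤-reflexive (sym tm≡)))
      (+-cancelʳ-≤ (suc q * m) (t * m) c (begin
        t * m + suc q * m  ≡⟨ split ⟨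
        suc j * m          ≤⟨ m≤n+m∸n (suc j * m) c ⟩
        c + (suc j * m ∸ c) ≤⟨ +-monoʳ-≤ c h ⟩
        c + suc q * m      ∎))
      where open ≤-Reasoning

  Linked⇒Chain-next : ∀ j b bs → b ≤ j * m → Bounded (suc j) bs → Linked _≼_ (b ∷ bs) →
    Chain m (next m (j * m ∸ b)) (complement (suc j) bs)
  Linked⇒Chain-next j b []       _  _        _         = tt
  Linked⇒Chain-next j b (c ∷ bs) b≤ (c≤ , h) (b⊴c ∷ l) =
    ⊴⇒≤next {j} b≤ b⊴c , Linked⇒Chain-next (suc j) c bs c≤ h l

  Linked⇒Chain : ∀ bs → Bounded 0 bs → Linked _≼_ bs → Chain m 0 (complement 0 bs)
  Linked⇒Chain []       _        _ = tt
  Linked⇒Chain (b ∷ bs) (b≤ , h) l = m∸n≤m 0 b , Linked⇒Chain-next 0 b bs b≤ h l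

  Chain-next⇒Linked : ∀ j b bs → b ≤ j * m → Bounded (suc j) bs →
    Chain m (next m (j * m ∸ b)) (complement (suc j) bs) → Linked _≼_ (b ∷ bs)
  Chain-next⇒Linked j b []       _  _        _       = [-]
  Chain-next⇒Linked j b (c ∷ bs) b≤ (c≤ , h) (p , r) =
    ≤next⇒⊴ {j} b≤ p ∷ Chain-next⇒Linked (suc j) c bs c≤ h r

  Chain⇒Linked : ∀ bs → Bounded 0 bs → Chain m 0 (complement 0 bs) → Linked _≼_ bs
  Chain⇒Linked []       _        _       = []
  Chain⇒Linked (b ∷ bs) (b≤ , h) (_ , r) = Chain-next⇒Linked 0 b bs b≤ h r

  -- A letter at most `j * m` has a `next` at most `suc j * m`, so every word of a chain is the
  -- complement of genuine heights.
  Chain⇒Bounded : ∀ {T} j w → T ≤ j * m → Chain m T w → Bounded j w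
  Chain⇒Bounded j []      _  _       = tt
  Chain⇒Bounded j (x ∷ w) T≤ (p , r) = ≤-trans p T≤ , Chain⇒Bounded (suc j) w
    (*-monoˡ-≤ m (s≤s (≤-trans (/-monoˡ-≤ m (≤-trans p T≤)) (≤-reflexive (m*n/n≡m j m))))) r

  -- The columns after `b` take at least one cell each, which leaves at most `j` for `b`. The strict
  -- inequality comes from the extra column in `N = |B| + 1`; with `|B|` columns the bound already
  -- fails for a single cell.
  positive⇒Bounded : ∀ j bs → All (0 <_) bs → sum bs < j + length bs → Bounded j bs
  positive⇒Bounded j []       _        _  = tt
  positive⇒Bounded j (b ∷ bs) (p ∷ ps) s< =
    ≤-trans b≤j (m≤m*n j m) ,
    positive⇒Bounded (suc j) bs ps (≤-<-trans (m≤n+m (sum bs) b) (<-≤-trans s< (≤-reflexive (+-suc j (length bs)))))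
    where
    b≤j : b ≤ j
    b≤j = ℕ.s≤s⁻¹ (+-cancelʳ-< (length bs) b (suc j)
      (≤-<-trans (+-monoʳ-≤ b (length≤sum ps)) (<-≤-trans s< (≤-reflexive (+-suc j (length bs))))))

  replicate-Bounded : ∀ j p {bs} → Bounded (j + p) bs → Bounded j (replicate p 0 ++ bs)
  replicate-Bounded j zero    {bs} h = subst (λ i → Bounded i bs) (+-identityʳ j) h
  replicate-Bounded j (suc p) {bs} h = z≤n , replicate-Bounded (suc j) p (subst (λ i → Bounded i bs) (+-suc j p) h)

  padTo-Bounded : ∀ bs → IsBoard bs → Bounded 0 (padTo (suc (size bs)) bs)
  padTo-Bounded bs hb = replicate-Bounded 0 (suc (size bs) ∸ length bs) (positive⇒Bounded _ bs ps
    (≤-reflexive (sym (m∸n+n≡m (m≤n⇒m≤1+n (length≤sum ps))))))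
    where ps = board-positive bs hb

  -- Rook numbers in terms of the roots

  cells-replicate : ∀ j p bs → cells' j (replicate p 0 ++ bs) ≡ cells' (j + p) bs
  cells-replicate j zero    bs = cong (λ i → cells' i bs) (sym (+-identityʳ j))
  cells-replicate j (suc p) bs = trans (cells-replicate (suc j) p bs) (cong (λ i → cells' i bs) (sym (+-suc j p)))

  module _ {bs : List ℕ} (l : Linked _≼_ bs) where

    placements≡rooks : ∀ j k → + placements m k [] (cells' j bs) ≡ rooks m (reverse bs) k
    placements≡rooks j k = trans
      (cong (λ b → + placements m k [] (cells' j b)) (sym (reverse-involutive bs)))
      (placements-cells m j (reverse bs) (AllPairs-reverse (Linked⇒AllPairs ⊴-trans l)) k)

    rook≡rooks : ∀ k → + rook m k bs ≡ rooks m (reverse bs) k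
    rook≡rooks k = trans (cong +_ (rook≡placements m k bs)) (placements≡rooks 1 k)

    -- Zero columns merely renumber the others, and `rooks` does not see the numbering.
    rook-replicate : ∀ p k → rook m k (replicate p 0 ++ bs) ≡ rook m k bs
    rook-replicate p k = ℤₚ.+-injective (begin
      + rook m k (replicate p 0 ++ bs)              ≡⟨ cong +_ (rook≡placements m k (replicate p 0 ++ bs)) ⟩
      + placements m k [] (cells (replicate p 0 ++ bs)) ≡⟨ cong (λ c → + placements m k [] c) (cells-replicate 1 p bs) ⟩
      + placements m k [] (cells' (1 + p) bs)       ≡⟨ placements≡rooks (1 + p) k ⟩
      rooks m (reverse bs) k                        ≡⟨ rook≡rooks k ⟨
      + rook m k bs                                 ∎)
      where open ≡-Reasoning

  rooks-0 : ∀ bs → rooks m bs 0 ≡ 1ℤ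
  rooks-0 []       = refl
  rooks-0 (b ∷ bs) = rooks-0 bs

  rooks-1 : ∀ bs → rooks m bs 1 ≡ + sum bs
  rooks-1 []       = refl
  rooks-1 (b ∷ bs) = trans (cong₂ (λ r s → r ℤ.+ (+ b ℤ.- 0ℤ ℤ.* + m) ℤ.* s) (rooks-1 bs) (rooks-0 bs))
    (identity (+ sum bs) (+ b) (+ m))
    where
    identity : ∀ s b m → s ℤ.+ (b ℤ.- 0ℤ ℤ.* m) ℤ.* 1ℤ ≡ b ℤ.+ s
    identity = solve-∀

  -- Equivalent boards therefore have equal size, and one padded length `N` serves them all.
  rook-1 : ∀ {bs} → Linked _≼_ bs → rook m 1 bs ≡ size bs
  rook-1 {bs} l = ℤₚ.+-injective (trans (rook≡rooks l 1)
    (trans (rooks-1 (reverse bs)) (cong +_ (sum-↭ (Permₚ.↭-reverse bs)))))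

  -- The same vector as roots j, for columns listed from right to left.
  rootsʳ : ℕ → List ℕ → List ℤ
  rootsʳ j []       = []
  rootsʳ j (b ∷ bs) = (+ ((j + length bs) * m) ℤ.- + b) ∷ rootsʳ j bs

  length-rootsʳ : ∀ j bs → length (rootsʳ j bs) ≡ length bs
  length-rootsʳ j []       = refl
  length-rootsʳ j (b ∷ bs) = cong suc (length-rootsʳ j bs)

  rootsʳ-snoc : ∀ j bs c → rootsʳ j (bs ∷ʳ c) ≡ rootsʳ (suc j) bs ∷ʳ (+ (j * m) ℤ.- + c)
  rootsʳ-snoc j []       c = cong (λ i → (+ (i * m) ℤ.- + c) ∷ []) (+-identityʳ j)
  rootsʳ-snoc j (b ∷ bs) c = cong₂ (λ i as → (+ (i * m) ℤ.- + b) ∷ as)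
    (trans (cong (_+_ j) (trans (length-++ bs) (+-comm (length bs) 1))) (+-suc j (length bs)))
    (rootsʳ-snoc j bs c)

  roots↭rootsʳ : ∀ j bs → roots j bs ↭ rootsʳ j (reverse bs)
  roots↭rootsʳ j []       = Perm.refl
  roots↭rootsʳ j (b ∷ bs) = ↭-trans (Perm.prep _ (roots↭rootsʳ (suc j) bs))
    (↭-trans (Permₚ.∷↭∷ʳ _ (rootsʳ (suc j) (reverse bs)))
      (↭-reflexive (trans (sym (rootsʳ-snoc j (reverse bs) b)) (cong (rootsʳ j) (sym (unfold-reverse b bs))))))

  -- With `a = l * m - b` the factor `(l - k) * m - a` of `expandStep` becomes `b - k * m`, the
  -- number of cells that `k` rooks leave free in a column of height `b`.
  rooks≡coeff : ∀ bs k → rooks m bs k ≡ coeff m (rootsʳ 0 bs) k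
  rooks≡coeff []       zero    = refl
  rooks≡coeff []       (suc k) = refl
  rooks≡coeff (b ∷ bs) zero    = rooks≡coeff bs zero
  rooks≡coeff (b ∷ bs) (suc k) = cong₂ ℤ._+_ (rooks≡coeff bs (suc k)) (cong₂ ℤ._*_ (begin
    + b ℤ.- + k ℤ.* + m
      ≡⟨ identity (+ l) (+ k) (+ m) (+ b) ⟩
    (+ l ℤ.- + k) ℤ.* + m ℤ.- (+ l ℤ.* + m ℤ.- + b)
      ≡⟨ cong₂ (λ l′ lm → (+ l′ ℤ.- + k) ℤ.* + m ℤ.- (lm ℤ.- + b)) (sym (length-rootsʳ 0 bs)) (sym (ℤₚ.pos-* l m)) ⟩
    (+ length (rootsʳ 0 bs) ℤ.- + k) ℤ.* + m ℤ.- (+ (l * m) ℤ.- + b) ∎) (rooks≡coeff bs k))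
    where
    open ≡-Reasoning
    l = length bs
    identity : ∀ l k m b → b ℤ.- k ℤ.* m ≡ (l ℤ.- k) ℤ.* m ℤ.- (l ℤ.* m ℤ.- b)
    identity = solve-∀

  rook≡coeff : ∀ {bs} → Linked _≼_ bs → ∀ k → + rook m k bs ≡ coeff m (roots 0 bs) k
  rook≡coeff {bs} l k = trans (rook≡rooks l k) (trans (rooks≡coeff (reverse bs) k)
    (coeff-↭ m (↭-sym (roots↭rootsʳ 0 bs)) k))

  length-roots : ∀ j bs → length (roots j bs) ≡ length bs
  length-roots j []       = refl
  length-roots j (b ∷ bs) = cong suc (length-roots (suc j) bs)

-- The bijection between words and equivalent boards

theorem5p2 : (m : ℕ) .{{_ : NonZero m}} (B : List ℕ) → IsBoard B → Singleton m B →
    let N = suc (size B)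
        n = cnt (zeta m (padTo N B))
    in Σ (List (List ℕ)) (λ L →
         Unique L
         × ((B' : List ℕ) → (B' ∈ L) ⇔ (IsBoard B' × Singleton m B' × LevelRookEquiv m B' B))
         × length L ≡ prodUpTo N (factor m n))
theorem5p2 m B hB sB = map board W , uniqueBoards , (λ B' → mk⇔ sound (complete B')) ,
  trans (length-map board W) W-length
  where
  N = suc (size B)
  n = cnt (zeta m (padTo N B))

  board : List ℕ → List ℕ
  board = strip ∘ complement m 0

  wordOf : List ℕ → List ℕ
  wordOf = complement m 0 ∘ padTo N

  padTo-Linked : ∀ bs → IsBoard bs → Singleton m bs → Linked (_⊴_ m) (padTo N bs)
  padTo-Linked bs hb sb = Linked-replicate m (N ∸ length bs) (Linked-⊴ m bs (board-≤ bs hb) sb)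

  padTo-length : ∀ bs → IsBoard bs → size bs ≡ size B → length (padTo N bs) ≡ N
  padTo-length bs hb eq = length-padTo N bs (m≤n⇒m≤1+n (≤-trans (length≤sum (board-positive bs hb)) (≤-reflexive eq)))

  lB = padTo-Linked B hB sB

  roots-B : roots m 0 (padTo N B) ≡ map +_ (wordOf B)
  roots-B = roots≡complement m 0 (padTo N B) (padTo-Bounded m B hB)

  n≡count : ∀ i → n i ≡ count i (wordOf B)
  n≡count i = trans (cong (λ ν → cnt ν i)
    (trans (zeta'≡roots m 0 (padTo N B) (Linked-⊴⇒Singleton m lB)) roots-B))
    (cnt-map (wordOf B) i)

  n≡0 : ∀ j → N * m ≤ j → n j ≡ 0
  n≡0 j Nm≤j = trans (n≡count j) (count-none (wordOf B)
    (All.map (λ x< → <⇒≢ (<-≤-trans x< Nm≤j))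
      (subst (λ l → All (_< l * m) (wordOf B)) (padTo-length B hB refl) (complement-< m 0 (padTo N B)))))

  enumeration = words-count m n N n≡0
  W = proj₁ enumeration
  W-enumerates = proj₁ (proj₂ enumeration)
  W-length = proj₂ (proj₂ enumeration)

  module Sound {w} (w∈W : w ∈ W) where

    w-word = Equivalence.to (proj₂ W-enumerates w) w∈W

    bs : List ℕ
    bs = complement m 0 w

    w-Bounded : Bounded m 0 w
    w-Bounded = Chain⇒Bounded m 0 w z≤n (Word.chain w-word)

    involutive : complement m 0 bs ≡ w
    involutive = complement-involutive m 0 w w-Bounded

    counts : ∀ i → count i w ≡ n i
    counts zero    = Word.lowest w-word
    counts (suc i) = Word.above w-word (suc i) z<s

    w↭ : w ↭ wordOf B
    w↭ = count⇒↭ w (wordOf B) (λ i → trans (counts i) (n≡count i))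

    bs-length : length bs ≡ N
    bs-length = trans (length-complement m 0 w) (trans (Permₚ.↭-length w↭)
      (trans (length-complement m 0 (padTo N B)) (padTo-length B hB refl)))

    padTo-board : padTo N (board w) ≡ bs
    padTo-board = trans (cong (λ k → padTo k (strip bs)) (sym bs-length)) (padTo-strip bs)

    bs-Linked : Linked (_⊴_ m) bs
    bs-Linked = Chain⇒Linked m bs (complement-Bounded m 0 w)
      (subst (Chain m 0) (sym involutive) (Word.chain w-word))

    left-inverse : wordOf (board w) ≡ w
    left-inverse = trans (cong (complement m 0) padTo-board) involutive

    rook-equivalent : LevelRookEquiv m (board w) B
    rook-equivalent k = ℤₚ.+-injective (begin
      + rook m k (board w)          ≡⟨ cong +_ (rook-replicate m (strip-Linked bs bs-Linked) (N ∸ length (board w)) k) ⟨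
      + rook m k (padTo N (board w)) ≡⟨ cong (λ b → + rook m k b) padTo-board ⟩
      + rook m k bs                 ≡⟨ rook≡coeff m bs-Linked k ⟩
      coeff m (roots m 0 bs) k      ≡⟨ cong (λ as → coeff m as k)
                                         (trans (roots≡complement m 0 bs (complement-Bounded m 0 w)) (cong (map (+_)) involutive)) ⟩
      coeff m (map +_ w) k          ≡⟨ coeff-↭ m (Permₚ.map⁺ +_ w↭) k ⟩
      coeff m (map +_ (wordOf B)) k ≡⟨ cong (λ as → coeff m as k) roots-B ⟨
      coeff m (roots m 0 (padTo N B)) k ≡⟨ rook≡coeff m lB k ⟨
      + rook m k (padTo N B)        ≡⟨ cong +_ (rook-replicate m (Linked-⊴ m B (board-≤ B hB) sB) (N ∸ length B) k) ⟩
      + rook m k B                  ∎)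
      where open ≡-Reasoning

  -- On `W` the map `wordOf` undoes `board`, so a repeated board would give a repeated word.
  uniqueBoards : Unique (map board W)
  uniqueBoards = Uniq.map⁻ {f = wordOf} (subst Unique (sym (retract W (λ w∈ → w∈))) (proj₁ W-enumerates))
    where
    retract : ∀ ws → (∀ {w} → w ∈ ws → w ∈ W) → map wordOf (map board ws) ≡ ws
    retract []       _  = refl
    retract (w ∷ ws) ⊆W = cong₂ _∷_ (Sound.left-inverse (⊆W (here refl))) (retract ws (⊆W ∘ there))

  sound : ∀ {B'} → B' ∈ map board W → IsBoard B' × Singleton m B' × LevelRookEquiv m B' B
  sound B'∈ with ∈-map⁻ board B'∈
  ... | w , w∈W , refl =
    strip-IsBoard bs (Linked.map (⊴⇒≤ m) bs-Linked) ,
    Linked-⊴⇒Singleton m (strip-Linked bs bs-Linked) ,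
    rook-equivalent
    where open Sound w∈W

  complete : ∀ B' → IsBoard B' × Singleton m B' × LevelRookEquiv m B' B → B' ∈ map board W
  complete B' (hB' , sB' , equiv) = subst (_∈ map board W) board-wordOf
    (∈-map⁺ board (Equivalence.from (proj₂ W-enumerates w) (word (All.universal (λ _ → z≤n) w)
      (Linked⇒Chain m (padTo N B') b' l') (counts 0) (λ i _ → counts i))))
    where
    w = wordOf B'

    l' = padTo-Linked B' hB' sB'

    l₀' = Linked-⊴ m B' (board-≤ B' hB') sB'
    l₀  = Linked-⊴ m B (board-≤ B hB) sB

    size≡ : size B' ≡ size B
    size≡ = trans (sym (rook-1 m l₀')) (trans (equiv 1) (rook-1 m l₀))

    -- The bound is known for padding by the size of `B'`; equal sizes turn this length into `N`.
    b' : Bounded m 0 (padTo N B')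
    b' = subst (λ s → Bounded m 0 (padTo (suc s) B')) size≡ (padTo-Bounded m B' hB')

    board-wordOf : board w ≡ B'
    board-wordOf = trans (cong strip (complement-involutive m 0 (padTo N B') b')) (strip-padTo N hB')

    roots↭ : roots m 0 (padTo N B') ↭ roots m 0 (padTo N B)
    roots↭ = coeff-injective m _ _
      (trans (length-roots m 0 (padTo N B')) (trans (padTo-length B' hB' size≡)
        (sym (trans (length-roots m 0 (padTo N B)) (padTo-length B hB refl)))))
      (λ k → trans (sym (rook≡coeff m l' k))
        (trans (cong +_ (trans (rook-replicate m l₀' (N ∸ length B') k)
                  (trans (equiv k) (sym (rook-replicate m l₀ (N ∸ length B) k)))))
          (rook≡coeff m lB k)))

    counts : ∀ i → count i w ≡ n i
    counts i = begin
      count i w                             ≡⟨ cnt-map w i ⟨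
      cnt (map +_ w) i                      ≡⟨ cong (λ ν → cnt ν i) (roots≡complement m 0 (padTo N B') b') ⟨
      cnt (roots m 0 (padTo N B')) i        ≡⟨ Permₚ.↭-length (Permₚ.filter-↭ (ℤ._≟ + i) roots↭) ⟩
      cnt (roots m 0 (padTo N B)) i         ≡⟨ cong (λ ν → cnt ν i) (zeta'≡roots m 0 (padTo N B) (Linked-⊴⇒Singleton m lB)) ⟨
      n i                                   ∎
      where open ≡-Reasoning
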